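{- Suppose $k$ is an infinite field, $(A_i)_{i\in I}$ a family of $k$-algebras, $B$ a $k$-algebra, and $f:A=\prod_{i\in I} A_i\to B$ a surjective $k$-algebra homomorphism. Suppose also either that (i) $\dim_k(B)<\mathrm{card}(k)$, or that (ii) $\dim_k(B)<2^{\aleph_0}$. Then the composite homomorphism $A\to B\to B/Z(B)$ (of $f$ with the quotient map) can be factored $$A\ \to\ A/\mathcal{U}_0\times\dots\times A/\mathcal{U}_{n-1}\ \to\ B/Z(B)\quad(n\in\omega),$$ where the first map is the product of the quotient maps and the $\mathcal{U}_m$ are ultrafilters on $I$, which in case (i) are $\mathrm{card}(k)^+$-complete, and in case (ii) are countably complete. Thus, if $\mathrm{card}(I)$ is less than every measurable cardinal $>\mathrm{card}(k)$ in case (i), or less than every uncountable measurable cardinal in case (ii) (in particular, in either case, if no such measurable cardinals exist), then the composite $A\to B\to B/Z(B)$ factors through the projection of $A$ to a finite subproduct $A_{i_0}\times\dots\times A_{i_{n-1}}$ ($i_0,\dots,i_{n-1}\in I$). In that situation, the original homomorphism $f:A\to B$ can be written as a sum $f=f_1+f_0$ of a $k$-algebra homomorphism $f_1:A\to B$ that factors through the projection of $A$ onto the product of finitely many of the $A_i$, and a $k$-algebra homomorphism $f_0:A\to Z(B)$.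
   Context: A $k$-algebra means a $k$-module $A$ with a $k$-bilinear multiplication $A\times A\to A$, not assumed associative, commutative, or unital. For an algebra $B$, the total annihilator ideal is $Z(B)=\{x\in B\mid xB=Bx=\{0\}\}$. For a filter $\mathcal{U}$ on $I$, $A/\mathcal{U}$ denotes the reduced product: the quotient of $\prod_{i\in I} A_i$ by the relation $(a_i)\sim(b_i)$ iff $\{i\mid a_i=b_i\}\in\mathcal{U}$, with induced algebra structure. An ultrafilter on $I$ is a maximal proper filter of subsets of $I$; it is principal if it has the form $\{J\subseteq I\mid i_0\in J\}$. A filter is $\kappa$-complete ($\kappa$ an infinite cardinal) if it is closed under intersections of families of $<\kappa$ members, and countably complete if it is $\aleph_1$-complete. $\mathrm{card}(k)^+$ is the successor cardinal of $\mathrm{card}(k)$. An infinite cardinal $\mu$ is measurable if there exists a nonprincipal $\mu$-complete ultrafilter on $\mu$ (so $\aleph_0$ counts as measurable). -}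

module Defs where

open import Algebra.Bundles using (CommutativeRing)
open import Algebra.Core using (Op₂)
import Algebra.Definitions as AlgebraDefinitions
import Algebra.Definitions.RawMonoid as RawMonoidDefinitions
open import Algebra.Module.Bundles using (LeftModule)
import Algebra.Module.Morphism.Construct.Composition as Composition
open import Algebra.Module.Morphism.Structures using (module LeftModuleMorphisms)
import Algebra.Module.Properties.LeftModule as LeftModuleProperties
import Algebra.Properties.AbelianGroup as AbelianGroupProperties
open import Data.Bool.Base using (Bool)
open import Data.Fin.Base using (Fin)
open import Data.Nat.Base using (ℕ)
open import Data.Product.Base using (Σ-syntax; ∃; ∃-syntax; _×_; _,_; proj₁; proj₂)
open import Function.Base using (_∘_)
open import Function.Bundles using (Injection; Inverse; _⇔_)
open import Function.Definitions using (Injective; Surjective)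
open import Level using (Level; 0ℓ; suc; _⊔_)
open import Relation.Binary.Bundles using (Setoid)
open import Relation.Binary.Core using (Rel; _=[_]⇒_)
open import Relation.Binary.Structures using (IsEquivalence)
open import Relation.Binary.PropositionalEquality using (_≡_; setoid; _→-setoid_)
import Relation.Binary.Reasoning.Setoid as SetoidReasoning
open import Relation.Nullary using (¬_)
open import Relation.Unary using (Pred; _∈_; _⊆_; _∩_; ⋂)
open import Relation.Unary.Polymorphic using (U; ∅)

private
  variable
    a a′ ℓ ℓ′ ℓ″ r ℓr i j : Level

-- Algebras are setoid-based, so quotients coarsen the equality; index sets and
-- cardinals are types with propositional equality.  Everything is read
-- classically: excluded middle for all types is a global choice operator, and
-- with function extensionality it respects equality of (Bool-valued) subsets,
-- which yields the axiom of choice and Zorn's lemma in their usual forms.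

infix 4 _≼_ _≺_

_≼_ : Setoid a ℓ → Setoid a′ ℓ′ → Set _
S ≼ T = Injection S T

_≺_ : Setoid a ℓ → Setoid a′ ℓ′ → Set _
S ≺ T = S ≼ T × ¬ (T ≼ S)

Finite : Setoid a ℓ → Set _
Finite S = ∃[ n ] Inverse S (setoid (Fin n))

Infinite : Setoid a ℓ → Set _
Infinite S = ¬ Finite S

ℵ₀ : Setoid 0ℓ 0ℓ
ℵ₀ = setoid ℕ

2^ℵ₀ : Setoid 0ℓ 0ℓ
2^ℵ₀ = ℕ →-setoid Bool

record Filter (I : Set ℓ) : Set (suc ℓ) where
  field
    sets     : Pred (Pred I ℓ) ℓ
    U-closed : U ∈ sets
    ⊆-closed : ∀ {J K} → J ∈ sets → J ⊆ K → K ∈ sets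
    ∩-closed : ∀ {J K} → J ∈ sets → K ∈ sets → J ∩ K ∈ sets

open Filter public using (sets)

module _ {I : Set ℓ} where

  Proper : Filter I → Set ℓ
  Proper 𝓕 = ¬ (∅ ∈ sets 𝓕)

  IsUltrafilter : Filter I → Set (suc ℓ)
  IsUltrafilter 𝓕 = Proper 𝓕 × (∀ 𝓖 → Proper 𝓖 → sets 𝓕 ⊆ sets 𝓖 → sets 𝓖 ⊆ sets 𝓕)

  IsPrincipal : Filter I → Set (suc ℓ)
  IsPrincipal 𝓕 = ∃[ i₀ ] ∀ J → J ∈ sets 𝓕 ⇔ i₀ ∈ J

  Complete : Setoid a ℓ′ → Filter I → Set _
  Complete κ 𝓕 = ∀ {X : Set ℓ} → setoid X ≺ κ →
                 (J : X → Pred I ℓ) → (∀ x → J x ∈ sets 𝓕) → ⋂ X J ∈ sets 𝓕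

  -- Completeness for the successor cardinal of κ: to have cardinality < κ⁺
  -- is to have cardinality ≤ κ.  In particular Complete⁺ ℵ₀ is countable
  -- (that is, ℵ₁-) completeness.
  Complete⁺ : Setoid a ℓ′ → Filter I → Set _
  Complete⁺ κ 𝓕 = ∀ {X : Set ℓ} → setoid X ≼ κ →
                  (J : X → Pred I ℓ) → (∀ x → J x ∈ sets 𝓕) → ⋂ X J ∈ sets 𝓕

Measurable : Set ℓ → Set (suc ℓ)
Measurable μ = Infinite (setoid μ) ×
  (Σ[ 𝓕 ∈ Filter μ ] IsUltrafilter 𝓕 × ¬ IsPrincipal 𝓕 × Complete (setoid μ) 𝓕)

record IsField (k : CommutativeRing r ℓr) : Set (r ⊔ ℓr) where
  open CommutativeRing k
  open AlgebraDefinitions _≈_ using (Invertible)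
  field
    1≉0        : ¬ (1# ≈ 0#)
    invertible : ∀ x → ¬ (x ≈ 0#) → Invertible 1# _*_ x

-- Left modules over a commutative ring carry the same information as
-- Module, without a second, coinciding scalar action.

record Algebra (k : CommutativeRing r ℓr) (a ℓ : Level) : Set (r ⊔ ℓr ⊔ suc (a ⊔ ℓ)) where
  infixl 7 _·_

  field
    leftModule : LeftModule (CommutativeRing.ring k) a ℓ

  open LeftModule leftModule public
  open AlgebraDefinitions _≈ᴹ_ using (Congruent₂; _DistributesOverˡ_; _DistributesOverʳ_)

  field
    _·_        : Op₂ Carrierᴹ
    ·-cong     : Congruent₂ _·_
    ·-distribˡ : _·_ DistributesOverˡ _+ᴹ_
    ·-distribʳ : _·_ DistributesOverʳ _+ᴹ_
    *ₗ-·       : ∀ r x y → (r *ₗ x) · y ≈ᴹ r *ₗ (x · y)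
    ·-*ₗ       : ∀ r x y → x · (r *ₗ y) ≈ᴹ r *ₗ (x · y)

  infixl 6 _-ᴹ_
  _-ᴹ_ : Op₂ Carrierᴹ
  x -ᴹ y = x +ᴹ (-ᴹ y)

module AlgebraProperties {k : CommutativeRing r ℓr} (A : Algebra k a ℓ) where
  private module k = CommutativeRing k
  open Algebra A
  open LeftModuleProperties leftModule
  open AbelianGroupProperties +ᴹ-abelianGroup using (⁻¹-∙-comm)
  open SetoidReasoning ≈ᴹ-setoid

  ·-zeroˡ : ∀ x → 0ᴹ · x ≈ᴹ 0ᴹ
  ·-zeroˡ x = begin
    0ᴹ · x             ≈⟨ ·-cong (≈ᴹ-sym (*ₗ-zeroˡ 0ᴹ)) ≈ᴹ-refl ⟩
    (k.0# *ₗ 0ᴹ) · x   ≈⟨ *ₗ-· k.0# 0ᴹ x ⟩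
    k.0# *ₗ (0ᴹ · x)   ≈⟨ *ₗ-zeroˡ (0ᴹ · x) ⟩
    0ᴹ                 ∎

  ·-zeroʳ : ∀ x → x · 0ᴹ ≈ᴹ 0ᴹ
  ·-zeroʳ x = begin
    x · 0ᴹ             ≈⟨ ·-cong ≈ᴹ-refl (≈ᴹ-sym (*ₗ-zeroˡ 0ᴹ)) ⟩
    x · (k.0# *ₗ 0ᴹ)   ≈⟨ ·-*ₗ k.0# x 0ᴹ ⟩
    k.0# *ₗ (x · 0ᴹ)   ≈⟨ *ₗ-zeroˡ (x · 0ᴹ) ⟩
    0ᴹ                 ∎

  -ᴹ-·ˡ : ∀ x y → (-ᴹ x) · y ≈ᴹ -ᴹ (x · y)
  -ᴹ-·ˡ x y = inverseʳ-uniqueᴹ (x · y) ((-ᴹ x) · y) (begin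
    x · y +ᴹ (-ᴹ x) · y  ≈⟨ ·-distribʳ y x (-ᴹ x) ⟨
    (x +ᴹ (-ᴹ x)) · y    ≈⟨ ·-cong (-ᴹ‿inverseʳ x) ≈ᴹ-refl ⟩
    0ᴹ · y               ≈⟨ ·-zeroˡ y ⟩
    0ᴹ                   ∎)

  -ᴹ-·ʳ : ∀ x y → x · (-ᴹ y) ≈ᴹ -ᴹ (x · y)
  -ᴹ-·ʳ x y = inverseʳ-uniqueᴹ (x · y) (x · (-ᴹ y)) (begin
    x · y +ᴹ x · (-ᴹ y)  ≈⟨ ·-distribˡ x y (-ᴹ y) ⟨
    x · (y +ᴹ (-ᴹ y))    ≈⟨ ·-cong ≈ᴹ-refl (-ᴹ‿inverseʳ y) ⟩
    x · 0ᴹ               ≈⟨ ·-zeroʳ x ⟩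
    0ᴹ                   ∎)

  *ₗ--ᴹ : ∀ r x → r *ₗ (-ᴹ x) ≈ᴹ -ᴹ (r *ₗ x)
  *ₗ--ᴹ r x = inverseʳ-uniqueᴹ (r *ₗ x) (r *ₗ (-ᴹ x)) (begin
    r *ₗ x +ᴹ r *ₗ (-ᴹ x)  ≈⟨ *ₗ-distribˡ r x (-ᴹ x) ⟨
    r *ₗ (x +ᴹ (-ᴹ x))     ≈⟨ *ₗ-cong k.refl (-ᴹ‿inverseʳ x) ⟩
    r *ₗ 0ᴹ                ≈⟨ *ₗ-zeroʳ r ⟩
    0ᴹ                     ∎)

  ≈⇒-ᴹ≈0 : ∀ {x y} → x ≈ᴹ y → x -ᴹ y ≈ᴹ 0ᴹ
  ≈⇒-ᴹ≈0 {x} {y} x≈y = ≈ᴹ-trans (+ᴹ-congʳ x≈y) (-ᴹ‿inverseʳ y)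

  -ᴹ-flip : ∀ x y → -ᴹ (x -ᴹ y) ≈ᴹ y -ᴹ x
  -ᴹ-flip x y = begin
    -ᴹ (x -ᴹ y)            ≈⟨ ⁻¹-∙-comm x (-ᴹ y) ⟨
    (-ᴹ x) +ᴹ -ᴹ (-ᴹ y)    ≈⟨ +ᴹ-congˡ (-ᴹ-involutive y) ⟩
    (-ᴹ x) +ᴹ y            ≈⟨ +ᴹ-comm (-ᴹ x) y ⟩
    y -ᴹ x                 ∎

  -ᴹ-telescope : ∀ x y z → (x -ᴹ y) +ᴹ (y -ᴹ z) ≈ᴹ x -ᴹ z
  -ᴹ-telescope x y z = begin
    (x -ᴹ y) +ᴹ (y -ᴹ z)           ≈⟨ +ᴹ-assoc x (-ᴹ y) (y -ᴹ z) ⟩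
    x +ᴹ ((-ᴹ y) +ᴹ (y -ᴹ z))      ≈⟨ +ᴹ-congˡ (+ᴹ-assoc (-ᴹ y) y (-ᴹ z)) ⟨
    x +ᴹ (((-ᴹ y) +ᴹ y) -ᴹ z)      ≈⟨ +ᴹ-congˡ (+ᴹ-congʳ (-ᴹ‿inverseˡ y)) ⟩
    x +ᴹ (0ᴹ -ᴹ z)                 ≈⟨ +ᴹ-congˡ (+ᴹ-identityˡ (-ᴹ z)) ⟩
    x -ᴹ z                         ∎

  -ᴹ-interchange : ∀ x x′ y y′ → (x -ᴹ x′) +ᴹ (y -ᴹ y′) ≈ᴹ (x +ᴹ y) -ᴹ (x′ +ᴹ y′)
  -ᴹ-interchange x x′ y y′ = begin
    (x -ᴹ x′) +ᴹ (y -ᴹ y′)               ≈⟨ +ᴹ-assoc x (-ᴹ x′) (y -ᴹ y′) ⟩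
    x +ᴹ ((-ᴹ x′) +ᴹ (y -ᴹ y′))          ≈⟨ +ᴹ-congˡ (+ᴹ-assoc (-ᴹ x′) y (-ᴹ y′)) ⟨
    x +ᴹ (((-ᴹ x′) +ᴹ y) -ᴹ y′)          ≈⟨ +ᴹ-congˡ (+ᴹ-congʳ (+ᴹ-comm (-ᴹ x′) y)) ⟩
    x +ᴹ ((y +ᴹ (-ᴹ x′)) -ᴹ y′)          ≈⟨ +ᴹ-congˡ (+ᴹ-assoc y (-ᴹ x′) (-ᴹ y′)) ⟩
    x +ᴹ (y +ᴹ ((-ᴹ x′) +ᴹ (-ᴹ y′)))     ≈⟨ +ᴹ-assoc x y _ ⟨
    (x +ᴹ y) +ᴹ ((-ᴹ x′) +ᴹ (-ᴹ y′))     ≈⟨ +ᴹ-congˡ (⁻¹-∙-comm x′ y′) ⟩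
    (x +ᴹ y) -ᴹ (x′ +ᴹ y′)               ∎

module _ {k : CommutativeRing r ℓr} (B : Algebra k a ℓ) where
  private module k = CommutativeRing k
  open Algebra B
  open RawMonoidDefinitions +ᴹ-rawMonoid using (sum)

  record IsBasis {X : Set i} (b : X → Carrierᴹ) : Set (r ⊔ ℓr ⊔ a ⊔ ℓ ⊔ i) where
    field
      independent : ∀ {n} (x : Fin n → X) → Injective _≡_ _≡_ x → (c : Fin n → k.Carrier) →
                    sum (λ m → c m *ₗ b (x m)) ≈ᴹ 0ᴹ → ∀ m → c m k.≈ k.0#
      spanning    : ∀ v → ∃[ n ] Σ[ x ∈ (Fin n → X) ] Σ[ c ∈ (Fin n → k.Carrier) ]
                    v ≈ᴹ sum (λ m → c m *ₗ b (x m))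

  Dimension≺ : Setoid a′ ℓ′ → Set _
  Dimension≺ κ = Σ[ X ∈ Set a ] (Σ[ b ∈ (X → Carrierᴹ) ] IsBasis b) × setoid X ≺ κ

module _ {k : CommutativeRing r ℓr} where

  record Hom (A : Algebra k a ℓ) (B : Algebra k a′ ℓ′) : Set (r ⊔ a ⊔ ℓ ⊔ a′ ⊔ ℓ′) where
    private
      module A = Algebra A
      module B = Algebra B
    field
      ⟦_⟧ : A.Carrierᴹ → B.Carrierᴹ
      isLeftModuleHomomorphism :
        LeftModuleMorphisms.IsLeftModuleHomomorphism A.rawLeftModule B.rawLeftModule ⟦_⟧
      ·-homo : ∀ x y → ⟦ x A.· y ⟧ B.≈ᴹ ⟦ x ⟧ B.· ⟦ y ⟧

    open LeftModuleMorphisms.IsLeftModuleHomomorphism isLeftModuleHomomorphism public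

  open Hom public using (⟦_⟧)

  module _ {A : Algebra k a ℓ} {B : Algebra k a′ ℓ′} where
    private
      module A = Algebra A
      module B = Algebra B

    IsSurjective : Hom A B → Set _
    IsSurjective f = Surjective A._≈ᴹ_ B._≈ᴹ_ ⟦ f ⟧

    mkHom : (f : A.Carrierᴹ → B.Carrierᴹ) →
            A._≈ᴹ_ =[ f ]⇒ B._≈ᴹ_ →
            (∀ x y → f (x A.+ᴹ y) B.≈ᴹ f x B.+ᴹ f y) →
            f A.0ᴹ B.≈ᴹ B.0ᴹ →
            (∀ x → f (A.-ᴹ x) B.≈ᴹ B.-ᴹ f x) →
            (∀ r x → f (r A.*ₗ x) B.≈ᴹ r B.*ₗ f x) →
            (∀ x y → f (x A.· y) B.≈ᴹ f x B.· f y) →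
            Hom A B
    mkHom f f-cong f-+ f-0 f-neg f-*ₗ f-· = record
      { ⟦_⟧ = f
      ; isLeftModuleHomomorphism = record
        { +ᴹ-isGroupHomomorphism = record
          { isMonoidHomomorphism = record
            { isMagmaHomomorphism = record
              { isRelHomomorphism = record { cong = f-cong }
              ; homo = f-+
              }
            ; ε-homo = f-0
            }
          ; ⁻¹-homo = f-neg
          }
        ; *ₗ-homo = f-*ₗ
        }
      ; ·-homo = f-·
      }

  infixr 9 _∘ₐ_

  _∘ₐ_ : ∀ {a₁ ℓ₁ a₂ ℓ₂ a₃ ℓ₃}
         {A : Algebra k a₁ ℓ₁} {B : Algebra k a₂ ℓ₂} {C : Algebra k a₃ ℓ₃} →
         Hom B C → Hom A B → Hom A C
  _∘ₐ_ {C = C} g f = record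
    { ⟦_⟧ = ⟦ g ⟧ ∘ ⟦ f ⟧
    ; isLeftModuleHomomorphism = Composition.isLeftModuleHomomorphism C.≈ᴹ-trans
        (Hom.isLeftModuleHomomorphism f) (Hom.isLeftModuleHomomorphism g)
    ; ·-homo = λ x y → C.≈ᴹ-trans (Hom.⟦⟧-cong g (Hom.·-homo f x y)) (Hom.·-homo g _ _)
    } where module C = Algebra C

  FactorsThrough : ∀ {a₁ ℓ₁ a₂ ℓ₂ a₃ ℓ₃}
                   {A : Algebra k a₁ ℓ₁} {B : Algebra k a₂ ℓ₂} {C : Algebra k a₃ ℓ₃} →
                   Hom A C → Hom A B → Set _
  FactorsThrough {B = B} {C = C} f p =
    Σ[ g ∈ Hom B C ] ∀ x → ⟦ f ⟧ x C.≈ᴹ ⟦ g ⟧ (⟦ p ⟧ x)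
    where module C = Algebra C

module _ {k : CommutativeRing r ℓr} where

  Π : {I : Set i} → (I → Algebra k a ℓ) → Algebra k (i ⊔ a) (i ⊔ ℓ)
  Π {I = I} A = record
    { leftModule = record
      { Carrierᴹ = ∀ n → A.Carrierᴹ n
      ; _≈ᴹ_     = λ x y → ∀ n → A._≈ᴹ_ n (x n) (y n)
      ; _+ᴹ_     = λ x y n → A._+ᴹ_ n (x n) (y n)
      ; _*ₗ_     = λ c x n → A._*ₗ_ n c (x n)
      ; 0ᴹ       = λ n → A.0ᴹ n
      ; -ᴹ_      = λ x n → A.-ᴹ_ n (x n)
      ; isLeftModule = record
        { isLeftSemimodule = record
          { +ᴹ-isCommutativeMonoid = record
            { isMonoid = record
              { isSemigroup = record
                { isMagma = record
                  { isEquivalence = record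
                    { refl  = λ n → A.≈ᴹ-refl n
                    ; sym   = λ p n → A.≈ᴹ-sym n (p n)
                    ; trans = λ p q n → A.≈ᴹ-trans n (p n) (q n)
                    }
                  ; ∙-cong = λ p q n → A.+ᴹ-cong n (p n) (q n)
                  }
                ; assoc = λ x y z n → A.+ᴹ-assoc n (x n) (y n) (z n)
                }
              ; identity = (λ x n → A.+ᴹ-identityˡ n (x n)) , (λ x n → A.+ᴹ-identityʳ n (x n))
              }
            ; comm = λ x y n → A.+ᴹ-comm n (x n) (y n)
            }
          ; isPreleftSemimodule = record
            { *ₗ-cong      = λ p q n → A.*ₗ-cong n p (q n)
            ; *ₗ-zeroˡ     = λ x n → A.*ₗ-zeroˡ n (x n)
            ; *ₗ-distribʳ  = λ x c d n → A.*ₗ-distribʳ n (x n) c d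
            ; *ₗ-identityˡ = λ x n → A.*ₗ-identityˡ n (x n)
            ; *ₗ-assoc     = λ c d x n → A.*ₗ-assoc n c d (x n)
            ; *ₗ-zeroʳ     = λ c n → A.*ₗ-zeroʳ n c
            ; *ₗ-distribˡ  = λ c x y n → A.*ₗ-distribˡ n c (x n) (y n)
            }
          }
        ; -ᴹ‿cong    = λ p n → A.-ᴹ‿cong n (p n)
        ; -ᴹ‿inverse = (λ x n → A.-ᴹ‿inverseˡ n (x n)) , (λ x n → A.-ᴹ‿inverseʳ n (x n))
        }
      }
    ; _·_        = λ x y n → A._·_ n (x n) (y n)
    ; ·-cong     = λ p q n → A.·-cong n (p n) (q n)
    ; ·-distribˡ = λ x y z n → A.·-distribˡ n (x n) (y n) (z n)
    ; ·-distribʳ = λ x y z n → A.·-distribʳ n (x n) (y n) (z n)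
    ; *ₗ-·       = λ c x y n → A.*ₗ-· n c (x n) (y n)
    ; ·-*ₗ       = λ c x y n → A.·-*ₗ n c (x n) (y n)
    }
    where module A (n : I) = Algebra (A n)

  tuple : {J : Set j} {A : Algebra k a ℓ} {B : J → Algebra k a′ ℓ′} →
          (∀ m → Hom A (B m)) → Hom A (Π B)
  tuple f = mkHom
    (λ x m → ⟦ f m ⟧ x)
    (λ p m → Hom.⟦⟧-cong (f m) p)
    (λ x y m → Hom.+ᴹ-homo (f m) x y)
    (λ m → Hom.0ᴹ-homo (f m))
    (λ x m → Hom.-ᴹ-homo (f m) x)
    (λ c x m → Hom.*ₗ-homo (f m) c x)
    (λ x y m → Hom.·-homo (f m) x y)

  projection : {I : Set i} (A : I → Algebra k a ℓ) (n : I) → Hom (Π A) (A n)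
  projection A n = mkHom (λ x → x n) (λ p → p n)
    (λ _ _ → ≈ᴹ-refl) ≈ᴹ-refl (λ _ → ≈ᴹ-refl) (λ _ _ → ≈ᴹ-refl) (λ _ _ → ≈ᴹ-refl)
    where open Algebra (A n)

  -- The projection to the subproduct of the A (s m), for s injective.
  subproduct : {I : Set i} (A : I → Algebra k a ℓ) {J : Set j} (s : J → I) →
               Hom (Π A) (Π (A ∘ s))
  subproduct A s = tuple (λ m → projection A (s m))

record Congruence {k : CommutativeRing r ℓr} (A : Algebra k a ℓ) (ℓ′ : Level)
                  : Set (r ⊔ a ⊔ ℓ ⊔ suc ℓ′) where
  open Algebra A
  infix 4 _≋_
  field
    _≋_           : Rel Carrierᴹ ℓ′
    isEquivalence : IsEquivalence _≋_
    ≈⇒≋           : ∀ {x y} → x ≈ᴹ y → x ≋ y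
    +-cong        : ∀ {x x′ y y′} → x ≋ x′ → y ≋ y′ → x +ᴹ y ≋ x′ +ᴹ y′
    -‿cong        : ∀ {x x′} → x ≋ x′ → -ᴹ x ≋ -ᴹ x′
    *ₗ-cong′      : ∀ c {x x′} → x ≋ x′ → c *ₗ x ≋ c *ₗ x′
    ·-cong′       : ∀ {x x′ y y′} → x ≋ x′ → y ≋ y′ → x · y ≋ x′ · y′

module _ {k : CommutativeRing r ℓr} (A : Algebra k a ℓ) (C : Congruence A ℓ′) where
  private
    module k = CommutativeRing k
    module C = Congruence C
  open Algebra A
  open Congruence C using (≈⇒≋)

  Quotient : Algebra k a ℓ′
  Quotient = record
    { leftModule = record
      { Carrierᴹ = Carrierᴹ
      ; _≈ᴹ_     = C._≋_
      ; _+ᴹ_     = _+ᴹ_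
      ; _*ₗ_     = _*ₗ_
      ; 0ᴹ       = 0ᴹ
      ; -ᴹ_      = -ᴹ_
      ; isLeftModule = record
        { isLeftSemimodule = record
          { +ᴹ-isCommutativeMonoid = record
            { isMonoid = record
              { isSemigroup = record
                { isMagma = record { isEquivalence = C.isEquivalence ; ∙-cong = C.+-cong }
                ; assoc = λ x y z → ≈⇒≋ (+ᴹ-assoc x y z)
                }
              ; identity = (λ x → ≈⇒≋ (+ᴹ-identityˡ x)) , (λ x → ≈⇒≋ (+ᴹ-identityʳ x))
              }
            ; comm = λ x y → ≈⇒≋ (+ᴹ-comm x y)
            }
          ; isPreleftSemimodule = record
            { *ₗ-cong      = λ {c} p q → IsEquivalence.trans C.isEquivalence
                               (C.*ₗ-cong′ c q) (≈⇒≋ (*ₗ-cong p ≈ᴹ-refl))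
            ; *ₗ-zeroˡ     = λ x → ≈⇒≋ (*ₗ-zeroˡ x)
            ; *ₗ-distribʳ  = λ x c d → ≈⇒≋ (*ₗ-distribʳ x c d)
            ; *ₗ-identityˡ = λ x → ≈⇒≋ (*ₗ-identityˡ x)
            ; *ₗ-assoc     = λ c d x → ≈⇒≋ (*ₗ-assoc c d x)
            ; *ₗ-zeroʳ     = λ c → ≈⇒≋ (*ₗ-zeroʳ c)
            ; *ₗ-distribˡ  = λ c x y → ≈⇒≋ (*ₗ-distribˡ c x y)
            }
          }
        ; -ᴹ‿cong    = C.-‿cong
        ; -ᴹ‿inverse = (λ x → ≈⇒≋ (-ᴹ‿inverseˡ x)) , (λ x → ≈⇒≋ (-ᴹ‿inverseʳ x))
        }
      }
    ; _·_        = _·_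
    ; ·-cong     = C.·-cong′
    ; ·-distribˡ = λ x y z → ≈⇒≋ (·-distribˡ x y z)
    ; ·-distribʳ = λ x y z → ≈⇒≋ (·-distribʳ x y z)
    ; *ₗ-·       = λ c x y → ≈⇒≋ (*ₗ-· c x y)
    ; ·-*ₗ       = λ c x y → ≈⇒≋ (·-*ₗ c x y)
    }

  quotientMap : Hom A Quotient
  quotientMap = mkHom (λ x → x) ≈⇒≋
    (λ _ _ → ≈⇒≋ ≈ᴹ-refl) (≈⇒≋ ≈ᴹ-refl) (λ _ → ≈⇒≋ ≈ᴹ-refl)
    (λ _ _ → ≈⇒≋ ≈ᴹ-refl) (λ _ _ → ≈⇒≋ ≈ᴹ-refl)

module _ {k : CommutativeRing r ℓr} {I : Set ℓ} (A : I → Algebra k a ℓ) (𝓕 : Filter I) where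
  private module A (n : I) = Algebra (A n)
  open Filter 𝓕 using (U-closed; ⊆-closed; ∩-closed)

  reducedCongruence : Congruence (Π A) ℓ
  reducedCongruence = record
    { _≋_ = λ x y → (λ n → A._≈ᴹ_ n (x n) (y n)) ∈ sets 𝓕
    ; isEquivalence = record
      { refl  = ⊆-closed U-closed (λ {n} _ → A.≈ᴹ-refl n)
      ; sym   = λ p → ⊆-closed p (λ {n} → A.≈ᴹ-sym n)
      ; trans = λ p q → ⊆-closed (∩-closed p q) (λ {n} (e , e′) → A.≈ᴹ-trans n e e′)
      }
    ; ≈⇒≋      = λ p → ⊆-closed U-closed (λ {n} _ → p n)
    ; +-cong   = λ p q → ⊆-closed (∩-closed p q) (λ {n} (e , e′) → A.+ᴹ-cong n e e′)
    ; -‿cong   = λ p → ⊆-closed p (λ {n} → A.-ᴹ‿cong n)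
    ; *ₗ-cong′ = λ c p → ⊆-closed p (λ {n} → A.*ₗ-cong n (CommutativeRing.refl k))
    ; ·-cong′  = λ p q → ⊆-closed (∩-closed p q) (λ {n} (e , e′) → A.·-cong n e e′)
    }

  ReducedProduct : Algebra k (ℓ ⊔ a) ℓ
  ReducedProduct = Quotient (Π A) reducedCongruence

  reducedProductMap : Hom (Π A) ReducedProduct
  reducedProductMap = quotientMap (Π A) reducedCongruence

record Ideal {k : CommutativeRing r ℓr} (B : Algebra k a ℓ) (ℓ′ : Level)
             : Set (r ⊔ a ⊔ ℓ ⊔ suc ℓ′) where
  open Algebra B
  field
    carrier   : Pred Carrierᴹ ℓ′
    resp      : ∀ {x y} → x ≈ᴹ y → x ∈ carrier → y ∈ carrier
    +-closed  : ∀ {x y} → x ∈ carrier → y ∈ carrier → x +ᴹ y ∈ carrier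
    0-closed  : 0ᴹ ∈ carrier
    -‿closed  : ∀ {x} → x ∈ carrier → -ᴹ x ∈ carrier
    *ₗ-closed : ∀ c {x} → x ∈ carrier → c *ₗ x ∈ carrier
    ·-closedˡ : ∀ x {y} → y ∈ carrier → x · y ∈ carrier
    ·-closedʳ : ∀ {x} y → x ∈ carrier → x · y ∈ carrier

module _ {k : CommutativeRing r ℓr} (B : Algebra k a ℓ) (J : Ideal B ℓ′) where
  private module J = Ideal J
  open Algebra B
  open AlgebraProperties B

  idealCongruence : Congruence B ℓ′
  idealCongruence = record
    { _≋_ = λ x y → x -ᴹ y ∈ J.carrier
    ; isEquivalence = record
      { refl  = λ {x} → J.resp (≈ᴹ-sym (-ᴹ‿inverseʳ x)) J.0-closed
      ; sym   = λ {x} {y} p → J.resp (-ᴹ-flip x y) (J.-‿closed p)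
      ; trans = λ {x} {y} {z} p q → J.resp (-ᴹ-telescope x y z) (J.+-closed p q)
      }
    ; ≈⇒≋      = λ p → J.resp (≈ᴹ-sym (≈⇒-ᴹ≈0 p)) J.0-closed
    ; +-cong   = λ {x} {x′} {y} {y′} p q →
                   J.resp (-ᴹ-interchange x x′ y y′) (J.+-closed p q)
    ; -‿cong   = λ {x} {x′} p → J.resp (≈ᴹ-sym (⁻¹-∙-comm x (-ᴹ x′))) (J.-‿closed p)
    ; *ₗ-cong′ = λ c {x} {x′} p → J.resp
                   (≈ᴹ-trans (*ₗ-distribˡ c x (-ᴹ x′)) (+ᴹ-congˡ (*ₗ--ᴹ c x′)))
                   (J.*ₗ-closed c p)
    ; ·-cong′  = λ {x} {x′} {y} {y′} p q → J.resp
                   (≈ᴹ-trans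
                     (+ᴹ-cong
                       (≈ᴹ-trans (·-distribʳ y x (-ᴹ x′)) (+ᴹ-congˡ (-ᴹ-·ˡ x′ y)))
                       (≈ᴹ-trans (·-distribˡ x′ y (-ᴹ y′)) (+ᴹ-congˡ (-ᴹ-·ʳ x′ y′))))
                     (-ᴹ-telescope (x · y) (x′ · y) (x′ · y′)))
                   (J.+-closed (J.·-closedʳ y p) (J.·-closedˡ x′ q))
    }
    where open AbelianGroupProperties +ᴹ-abelianGroup using (⁻¹-∙-comm)

  idealAlgebra : Algebra k (a ⊔ ℓ′) ℓ
  idealAlgebra = record
    { leftModule = record
      { Carrierᴹ = ∃ J.carrier
      ; _≈ᴹ_     = λ x y → proj₁ x ≈ᴹ proj₁ y
      ; _+ᴹ_     = λ (x , p) (y , q) → x +ᴹ y , J.+-closed p q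
      ; _*ₗ_     = λ c (x , p) → c *ₗ x , J.*ₗ-closed c p
      ; 0ᴹ       = 0ᴹ , J.0-closed
      ; -ᴹ_      = λ (x , p) → -ᴹ x , J.-‿closed p
      ; isLeftModule = record
        { isLeftSemimodule = record
          { +ᴹ-isCommutativeMonoid = record
            { isMonoid = record
              { isSemigroup = record
                { isMagma = record
                  { isEquivalence = record
                    { refl = ≈ᴹ-refl ; sym = ≈ᴹ-sym ; trans = ≈ᴹ-trans }
                  ; ∙-cong = +ᴹ-cong
                  }
                ; assoc = λ (x , _) (y , _) (z , _) → +ᴹ-assoc x y z
                }
              ; identity = (λ (x , _) → +ᴹ-identityˡ x) , (λ (x , _) → +ᴹ-identityʳ x)
              }
            ; comm = λ (x , _) (y , _) → +ᴹ-comm x y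
            }
          ; isPreleftSemimodule = record
            { *ₗ-cong      = *ₗ-cong
            ; *ₗ-zeroˡ     = λ (x , _) → *ₗ-zeroˡ x
            ; *ₗ-distribʳ  = λ (x , _) c d → *ₗ-distribʳ x c d
            ; *ₗ-identityˡ = λ (x , _) → *ₗ-identityˡ x
            ; *ₗ-assoc     = λ c d (x , _) → *ₗ-assoc c d x
            ; *ₗ-zeroʳ     = *ₗ-zeroʳ
            ; *ₗ-distribˡ  = λ c (x , _) (y , _) → *ₗ-distribˡ c x y
            }
          }
        ; -ᴹ‿cong    = -ᴹ‿cong
        ; -ᴹ‿inverse = (λ (x , _) → -ᴹ‿inverseˡ x) , (λ (x , _) → -ᴹ‿inverseʳ x)
        }
      }
    ; _·_        = λ (x , p) (y , _) → x · y , J.·-closedʳ y p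
    ; ·-cong     = ·-cong
    ; ·-distribˡ = λ (x , _) (y , _) (z , _) → ·-distribˡ x y z
    ; ·-distribʳ = λ (x , _) (y , _) (z , _) → ·-distribʳ x y z
    ; *ₗ-·       = λ c (x , _) (y , _) → *ₗ-· c x y
    ; ·-*ₗ       = λ c (x , _) (y , _) → ·-*ₗ c x y
    }

module _ {k : CommutativeRing r ℓr} (B : Algebra k a ℓ) where
  open Algebra B
  open AlgebraProperties B
  open AbelianGroupProperties +ᴹ-abelianGroup using (ε⁻¹≈ε)

  annihilator : Ideal B (a ⊔ ℓ)
  annihilator = record
    { carrier   = λ x → ∀ y → x · y ≈ᴹ 0ᴹ × y · x ≈ᴹ 0ᴹ
    ; resp      = λ x≈x′ x∈Z y →
                    ≈ᴹ-trans (·-cong (≈ᴹ-sym x≈x′) ≈ᴹ-refl) (proj₁ (x∈Z y)) ,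
                    ≈ᴹ-trans (·-cong ≈ᴹ-refl (≈ᴹ-sym x≈x′)) (proj₂ (x∈Z y))
    ; +-closed  = λ {x} {x′} x∈Z x′∈Z y →
                    ≈ᴹ-trans (·-distribʳ y x x′)
                      (≈ᴹ-trans (+ᴹ-cong (proj₁ (x∈Z y)) (proj₁ (x′∈Z y))) (+ᴹ-identityˡ 0ᴹ)) ,
                    ≈ᴹ-trans (·-distribˡ y x x′)
                      (≈ᴹ-trans (+ᴹ-cong (proj₂ (x∈Z y)) (proj₂ (x′∈Z y))) (+ᴹ-identityˡ 0ᴹ))
    ; 0-closed  = λ y → ·-zeroˡ y , ·-zeroʳ y
    ; -‿closed  = λ {x} x∈Z y →
                    ≈ᴹ-trans (-ᴹ-·ˡ x y) (≈ᴹ-trans (-ᴹ‿cong (proj₁ (x∈Z y))) ε⁻¹≈ε) ,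
                    ≈ᴹ-trans (-ᴹ-·ʳ y x) (≈ᴹ-trans (-ᴹ‿cong (proj₂ (x∈Z y))) ε⁻¹≈ε)
    ; *ₗ-closed = λ c {x} x∈Z y →
                    ≈ᴹ-trans (*ₗ-· c x y)
                      (≈ᴹ-trans (*ₗ-cong (CommutativeRing.refl k) (proj₁ (x∈Z y))) (*ₗ-zeroʳ c)) ,
                    ≈ᴹ-trans (·-*ₗ c y x)
                      (≈ᴹ-trans (*ₗ-cong (CommutativeRing.refl k) (proj₂ (x∈Z y))) (*ₗ-zeroʳ c))
    ; ·-closedˡ = λ x y∈Z z →
                    ≈ᴹ-trans (·-cong (proj₂ (y∈Z x)) ≈ᴹ-refl) (·-zeroˡ z) ,
                    ≈ᴹ-trans (·-cong ≈ᴹ-refl (proj₂ (y∈Z x))) (·-zeroʳ z)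
    ; ·-closedʳ = λ y x∈Z z →
                    ≈ᴹ-trans (·-cong (proj₁ (x∈Z y)) ≈ᴹ-refl) (·-zeroˡ z) ,
                    ≈ᴹ-trans (·-cong ≈ᴹ-refl (proj₁ (x∈Z y))) (·-zeroʳ z)
    }

  Z : Algebra k (a ⊔ ℓ) ℓ
  Z = idealAlgebra B annihilator

  _/Z : Algebra k a (a ⊔ ℓ)
  _/Z = Quotient B (idealCongruence B annihilator)

  π : Hom B _/Z
  π = quotientMap B (idealCongruence B annihilator)

module _ {k : CommutativeRing r ℓr} {I : Set ℓ} (A : I → Algebra k a ℓ) where

  FactorsThroughUltraproducts : {C : Algebra k a′ ℓ′} →
    (Filter I → Set ℓ″) → Hom (Π A) C → Set _
  FactorsThroughUltraproducts P f =
    ∃[ n ] Σ[ 𝒰 ∈ (Fin n → Filter I) ]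
      (∀ m → IsUltrafilter (𝒰 m) × P (𝒰 m)) ×
      FactorsThrough f (tuple (λ m → reducedProductMap A (𝒰 m)))

  FactorsThroughFiniteSubproduct : {C : Algebra k a′ ℓ′} → Hom (Π A) C → Set _
  FactorsThroughFiniteSubproduct f =
    ∃[ n ] Σ[ s ∈ (Fin n → I) ] Injective _≡_ _≡_ s × FactorsThrough f (subproduct A s)

  Decomposes : {B : Algebra k a′ ℓ′} → Hom (Π A) B → Set _
  Decomposes {B = B} f =
    Σ[ f₁ ∈ Hom (Π A) B ] Σ[ f₀ ∈ Hom (Π A) (Z B) ]
      FactorsThroughFiniteSubproduct f₁ ×
      (∀ x → ⟦ f ⟧ x B.≈ᴹ ⟦ f₁ ⟧ x B.+ᴹ proj₁ (⟦ f₀ ⟧ x))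
    where module B = Algebra B

BelowMeasurablesAbove : Setoid a′ ℓ′ → Set ℓ → Set _
BelowMeasurablesAbove {ℓ = ℓ} κ I =
  (μ : Set ℓ) → Measurable μ → κ ≺ setoid μ → setoid I ≺ setoid μ

{-# OPTIONS --safe #-}
module Submission where

-- Call a ∈ ∏ Aᵢ negligible if f(a) ∈ Z(B), and J ⊆ I null if all a supported on J are
-- negligible.  Since f(ua) f(b) = f(a) f(ub) for u ∈ k^I, negligible elements form a
-- k^I-submodule.  If S is a set and dim B is less than the size of some linearly independent
-- family in k^S all of whose nontrivial combinations have finitely many zeros, then every
-- linear map k^S → B kills some u with finitely many zeros.  Applied to u ↦ f(ua), with u
-- constant on the parts of a partition indexed by S, this shows that unions of S-indexed
-- families of null sets are null, and (S = ℕ) that there is no infinite sequence of disjoint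
-- non-null sets.  So, modulo null sets, I is a finite union of atoms, and each atom gives an
-- ultrafilter.  Suitable families are 1/(c − t), c ∈ k, if S embeds in k by t, and, on S = ℕ,
-- 2^ℵ₀ functions whose values at n depend generically on the first n digits of a branch of
-- the binary tree.

open import Defs
open import Algebra.Bundles using (CommutativeMonoid; CommutativeRing)
import Algebra.Definitions.RawMonoid as RawMonoidDefinitions
open import Algebra.Module.Bundles using (LeftModule)
import Algebra.Module.Construct.TensorUnit as TensorUnit
import Algebra.Module.Properties.LeftModule as LeftModuleProperties
import Algebra.Properties.AbelianGroup as AbelianGroupProperties
import Algebra.Properties.CommutativeSemigroup as CommutativeSemigroupProperties
import Algebra.Properties.Ring as RingProperties
import Algebra.Solver.Ring.NaturalCoefficients.Default as SemiringSolver
open import Axiom.ExcludedMiddle using (ExcludedMiddle)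
open import Axiom.Extensionality.Propositional using (Extensionality)
open import Data.Bool.Base using (Bool; true; false; T)
open import Data.Bool.Properties using (T-irrelevant)
open import Data.Empty using (⊥; ⊥-elim)
open import Data.Fin.Base using (Fin; zero; suc)
open import Data.List.Base using
  (List; []; _∷_; _++_; map; length; lookup; upTo; allFin; cartesianProduct;
   cartesianProductWith; deduplicate)
open import Data.List.Membership.Propositional using (_∈_; _∉_)
open import Data.List.Membership.Propositional.Properties using
  (∈-++⁺ˡ; ∈-++⁺ʳ; ∈-map⁺; ∈-upTo⁺; ∈-allFin; ∈-lookup; ∈-cartesianProductWith⁺;
   ∈-cartesianProduct⁺; ∈-deduplicate⁺)
import Data.List.Membership.Setoid as SetoidMembership
import Data.List.Membership.Setoid.Properties as SetoidMembershipProperties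
open import Data.List.Properties using (length-map)
open import Data.List.Relation.Unary.All as All using (All; []; _∷_)
open import Data.List.Relation.Unary.All.Properties using (++⁺; map⁺; ¬All⇒Any¬)
open import Data.List.Relation.Unary.AllPairs using ([]; _∷_)
open import Data.List.Relation.Unary.Any as Any using (Any; here; there)
import Data.List.Relation.Unary.Any.Properties as Any
open import Data.List.Relation.Unary.Unique.Setoid using (Unique)
import Data.List.Relation.Unary.Unique.DecSetoid.Properties as Unique
open import Data.Maybe.Base as Maybe using (Maybe; just; nothing; maybe′)
open import Data.Nat.Base as ℕ using (ℕ; zero; suc)
import Data.Nat.ListAction as ListAction
import Data.Nat.Properties as ℕ
open import Data.Product.Base using (Σ; Σ-syntax; ∃; ∃-syntax; _×_; _,_; proj₁; proj₂)
open import Data.Sum.Base using (_⊎_; inj₁; inj₂; [_,_]′)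
open import Data.Unit.Base using (tt)
open import Data.Unit.Polymorphic.Base using (⊤)
open import Data.Vec.Base using (Vec; []; _∷_)
import Data.Vec.Properties as Vec
open import Function.Base using (_∘_; id)
open import Function.Bundles using (Injection; Inverse; Equivalence; mk↣)
import Function.Construct.Composition as Composition
open import Level using (Level; Lift; lift; lower; _⊔_)
open import Relation.Binary.Bundles using (Setoid; DecSetoid)
open import Relation.Binary.Definitions using (tri<; tri≈; tri>)
open import Relation.Binary.PropositionalEquality as ≡ using (_≡_; _≢_; cong; cong₂; subst)
open import Relation.Binary.PropositionalEquality.Properties using (decSetoid)
import Relation.Binary.Reasoning.Setoid as SetoidReasoning
open import Relation.Nullary using (¬_; Dec; yes; no)
open import Relation.Nullary.Decidable using (isYes; toWitness; fromWitness; decidable-stable)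
open import Relation.Unary using (Pred; ∁; _⊆_; _∩_) renaming (_∈_ to _∈ᵘ_)

-- B is replaced by B/Z(B) because the kernel of f, though an ideal, need not be stable under k^I.
-- The preimage of Z(B) is stable, so there a killed product u a can be divided by u wherever u is
-- nonzero.
--
-- Neither family can replace the other. There are card(k) reciprocals, possibly fewer than 2^ℵ₀,
-- while the tree functions live on ℕ. The obstacle for the tree is that a generic choice at one
-- level avoids only finitely many linear functionals, whereas the coefficients of a combination
-- range over an infinite field. Elimination overcomes this: an unknown coefficient either meets a
-- factor 0 or is cancelled between two zeros, and the coefficients that remain are built from
-- values at earlier levels, so they belong to finite lists fixed in advance.
--
-- That the ultrafilters are principal under the cardinality hypothesis needs no algebra: otherwise
-- a smallest set receiving a map from I with small fibres would be a measurable cardinal above κ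
-- and of size at most |I|.

Subset : ∀ {a} → Set a → Set a
Subset X = X → Bool

module _ {a} {X : Set a} where

  infix 4 _⊑_

  _⊑_ : Subset X → Subset X → Set a
  S ⊑ S′ = ∀ x → T (S x) → T (S′ x)

  Elements : Subset X → Set a
  Elements S = Σ X (T ∘ S)

  Elements-≡ : ∀ {S : Subset X} {x y : Elements S} → proj₁ x ≡ proj₁ y → x ≡ y
  Elements-≡ {x = x , p} {.x , q} ≡.refl = cong (x ,_) (T-irrelevant p q)

-- Classical reasoning and Bool-valued subsets

module Classical (em : ∀ {a} → ExcludedMiddle a) where

  stable : ∀ {p} {P : Set p} → ¬ ¬ P → P
  stable = decidable-stable em

  ¬∀⇒∃¬ : ∀ {a p} {X : Set a} {P : X → Set p} → ¬ (∀ x → P x) → ∃[ x ] ¬ P x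
  ¬∀⇒∃¬ ¬∀ = stable (λ ¬∃ → ¬∀ (λ x → stable (λ ¬Px → ¬∃ (x , ¬Px))))

  ⌊_⌋ : ∀ {p} → Set p → Bool
  ⌊ P ⌋ = isYes (em {P = P})

  to⌊⌋ : ∀ {p} {P : Set p} → P → T ⌊ P ⌋
  to⌊⌋ {P = P} = fromWitness {a? = em {P = P}}

  from⌊⌋ : ∀ {p} {P : Set p} → T ⌊ P ⌋ → P
  from⌊⌋ {P = P} = toWitness {a? = em {P = P}}

  module _ {a} {X : Set a} where

    insert : Subset X → X → Subset X
    insert S x y = ⌊ T (S y) ⊎ y ≡ x ⌋

    -- Bool-valued subsets stay in the universe of `X`, so families of subsets can be united without
    -- a rise in level, and extensionality turns mutual inclusion into equality.
    ⋃ˢ : Subset (Subset X) → Subset X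
    ⋃ˢ 𝒬 x = ⌊ (∃[ S ] T (𝒬 S) × T (S x)) ⌋

    IsChain : Subset (Subset X) → Set a
    IsChain 𝒬 = ∀ S S′ → T (𝒬 S) → T (𝒬 S′) → S ⊑ S′ ⊎ S′ ⊑ S

    ⊑-⋃ˢ : ∀ {𝒬 S} → T (𝒬 S) → S ⊑ ⋃ˢ 𝒬
    ⊑-⋃ˢ S∈𝒬 x x∈S = to⌊⌋ (_ , S∈𝒬 , x∈S)

-- Zorn's lemma and the comparison of cardinals

module Cardinals (em : ∀ {a} → ExcludedMiddle a) (ext : ∀ {a b} → Extensionality a b) where
  open Classical em

  T-ext : ∀ {b c} → (T b → T c) → (T c → T b) → b ≡ c
  T-ext {false} {false} _ _ = ≡.refl
  T-ext {false} {true}  _ g = ⊥-elim (g tt)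
  T-ext {true}  {false} f _ = ⊥-elim (f tt)
  T-ext {true}  {true}  _ _ = ≡.refl

  ⊑-antisym : ∀ {a} {X : Set a} {S S′ : Subset X} → S ⊑ S′ → S′ ⊑ S → S ≡ S′
  ⊑-antisym p q = ext (λ x → T-ext (p x) (q x))

  -- Zorn's lemma: iterating one-point extensions and unions transfinitely gives a chain, so
  -- its union is the last iterate and cannot be extended.
  module Zorn {a p} {X : Set a} (𝒫 : Pred (Subset X) p)
              (chain-closed : ∀ 𝒬 → (∀ S → T (𝒬 S) → 𝒫 S) → IsChain 𝒬 → 𝒫 (⋃ˢ 𝒬)) where

    Extension : Subset X → Set (a ⊔ p)
    Extension S = ∃[ x ] ¬ T (S x) × 𝒫 (insert S x)

    extend : ∀ S → Dec (Extension S) → Subset X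
    extend S (yes (x , _)) = insert S x
    extend S (no _)        = S

    next : Subset X → Subset X
    next S = extend S em

    -- The iteration starts from `union` of the empty family, so `chain-closed` is also applied to
    -- the empty chain.
    data Iterate : Subset X → Set a where
      step  : ∀ {S} → Iterate S → Iterate (next S)
      union : ∀ 𝒬 → (∀ S → T (𝒬 S) → Iterate S) → Iterate (⋃ˢ 𝒬)

    ⊑-next : ∀ S → S ⊑ next S
    ⊑-next S = go em
      where
      go : (d : Dec (Extension S)) → S ⊑ extend S d
      go (yes _) _ x∈S = to⌊⌋ (inj₁ x∈S)
      go (no _)  _ x∈S = x∈S

    -- `next S′` has at most one point more than `S′`, so everything depends on whether `S` contains
    -- that point.
    next-minimal : ∀ {S S′} → S′ ⊑ S → S ⊑ next S′ → S ⊑ S′ ⊎ next S′ ⊑ S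
    next-minimal {S} {S′} S′⊑S = go em
      where
      go : (d : Dec (Extension S′)) → S ⊑ extend S′ d → S ⊑ S′ ⊎ extend S′ d ⊑ S
      go (no _)        S⊑ = inj₁ S⊑
      go (yes (x , _)) S⊑ with em {P = T (S x)}
      ... | yes x∈S = inj₂ λ y y∈ → case-insert (from⌊⌋ y∈)
        where
        case-insert : ∀ {y} → T (S′ y) ⊎ y ≡ x → T (S y)
        case-insert (inj₁ y∈S′) = S′⊑S _ y∈S′
        case-insert (inj₂ ≡.refl) = x∈S
      ... | no  x∉S = inj₁ λ y y∈S → case-insert y∈S (from⌊⌋ (S⊑ y y∈S))
        where
        case-insert : ∀ {y} → T (S y) → T (S′ y) ⊎ y ≡ x → T (S′ y)
        case-insert _   (inj₁ y∈S′) = y∈S′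
        case-insert y∈S (inj₂ ≡.refl) = ⊥-elim (x∉S y∈S)

    Comparable : Subset X → Set a
    Comparable S = ∀ {S′} → Iterate S′ → S ⊑ S′ ⊎ S′ ⊑ S

    -- The Bourbaki-Witt dichotomy: no iterate lies strictly between a comparable `S` and its
    -- successor. A second induction then makes all iterates comparable.
    next-⊑ : ∀ {S} → Comparable S → ∀ {S′} → Iterate S′ → S′ ⊑ S ⊎ next S ⊑ S′
    next-⊑ {S} c (step {S′} it) with next-⊑ c it
    ... | inj₂ S⁺⊑S′ = inj₂ λ x → ⊑-next S′ x ∘ S⁺⊑S′ x
    ... | inj₁ S′⊑S with c (step it)
    ...   | inj₂ S′⁺⊑S = inj₁ S′⁺⊑S
    ...   | inj₁ S⊑S′⁺ with next-minimal S′⊑S S⊑S′⁺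
    ...     | inj₂ S′⁺⊑S = inj₁ S′⁺⊑S
    ...     | inj₁ S⊑S′ with ⊑-antisym S⊑S′ S′⊑S
    ...       | ≡.refl = inj₂ λ _ → id
    next-⊑ {S} c (union 𝒬 its) with em {P = ∃[ S′ ] T (𝒬 S′) × next S ⊑ S′}
    ... | yes (S′ , S′∈𝒬 , S⁺⊑S′) = inj₂ λ x → ⊑-⋃ˢ S′∈𝒬 x ∘ S⁺⊑S′ x
    ... | no ¬∃ = inj₁ λ x x∈ → below (from⌊⌋ x∈)
      where
      below : ∀ {x} → (∃[ S′ ] T (𝒬 S′) × T (S′ x)) → T (S x)
      below (S′ , S′∈𝒬 , x∈S′) with next-⊑ c (its S′ S′∈𝒬)
      ... | inj₁ S′⊑S  = S′⊑S _ x∈S′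
      ... | inj₂ S⁺⊑S′ = ⊥-elim (¬∃ (S′ , S′∈𝒬 , S⁺⊑S′))

    comparable : ∀ {S} → Iterate S → Comparable S
    comparable (step {S} it) it′ with next-⊑ (comparable it) it′
    ... | inj₁ S′⊑S  = inj₂ λ x → ⊑-next S x ∘ S′⊑S x
    ... | inj₂ S⁺⊑S′ = inj₁ S⁺⊑S′
    comparable (union 𝒬 its) {S′} it′ with em {P = ∃[ S ] T (𝒬 S) × S′ ⊑ S}
    ... | yes (S , S∈𝒬 , S′⊑S) = inj₂ λ x → ⊑-⋃ˢ S∈𝒬 x ∘ S′⊑S x
    ... | no ¬∃ = inj₁ λ x x∈ → below (from⌊⌋ x∈)
      where
      below : ∀ {x} → (∃[ S ] T (𝒬 S) × T (S x)) → T (S′ x)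
      below (S , S∈𝒬 , x∈S) with comparable (its S S∈𝒬) it′
      ... | inj₁ S⊑S′ = S⊑S′ _ x∈S
      ... | inj₂ S′⊑S = ⊥-elim (¬∃ (S , S∈𝒬 , S′⊑S))

    Iterate⇒𝒫 : ∀ {S} → Iterate S → 𝒫 S
    Iterate⇒𝒫 (step {S} it) = go em
      where
      go : (d : Dec (Extension S)) → 𝒫 (extend S d)
      go (yes (_ , _ , q)) = q
      go (no _)            = Iterate⇒𝒫 it
    Iterate⇒𝒫 (union 𝒬 its) = chain-closed 𝒬 (λ S S∈𝒬 → Iterate⇒𝒫 (its S S∈𝒬))
      (λ S S′ S∈𝒬 S′∈𝒬 → comparable (its S S∈𝒬) (its S′ S′∈𝒬))

    maximal : ∃[ S ] 𝒫 S × (∀ x → ¬ T (S x) → ¬ 𝒫 (insert S x))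
    maximal = last , Iterate⇒𝒫 last-iterate , unextendable em (⊑-⋃ˢ (to⌊⌋ (step last-iterate)))
      where
      iterates : Subset (Subset X)
      iterates S = ⌊ Iterate S ⌋

      last : Subset X
      last = ⋃ˢ iterates

      last-iterate : Iterate last
      last-iterate = union iterates (λ _ → from⌊⌋)

      unextendable : (d : Dec (Extension last)) → extend last d ⊑ last →
                     ∀ x → ¬ T (last x) → ¬ 𝒫 (insert last x)
      unextendable (yes (x , x∉ , _)) ⊑last = ⊥-elim (x∉ (⊑last x (to⌊⌋ (inj₂ ≡.refl))))
      unextendable (no ¬ext)          _ x x∉ q = ¬ext (x , x∉ , q)

  -- Hönig's argument: take a maximal set of choice functions that pairwise differ
  -- everywhere.  It maps onto some X t₀, and bijectively so.
  smallest : ∀ {t x} {I : Set t} (X : I → Set x) → I →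
             ∃[ t₀ ] ∀ t → Σ[ φ ∈ (X t₀ → X t) ] (∀ {y z} → φ y ≡ φ z → y ≡ z)
  smallest {t} {x} {I} X i₀ with Zorn.maximal Separated chain-closed
    where
    Separated : Subset (∀ t → X t) → Set _
    Separated F = ∀ f g → T (F f) → T (F g) → ∀ t → f t ≡ g t → f ≡ g

    chain-closed : ∀ 𝒬 → (∀ S → T (𝒬 S) → Separated S) → IsChain 𝒬 → Separated (⋃ˢ 𝒬)
    chain-closed 𝒬 sep chain f g f∈ g∈ t ft≡gt =
      let (S , S∈𝒬 , f∈S) = from⌊⌋ f∈
          (S′ , S′∈𝒬 , g∈S′) = from⌊⌋ g∈
      in [ (λ S⊑S′ → sep S′ S′∈𝒬 f g (S⊑S′ f f∈S) g∈S′ t ft≡gt)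
         , (λ S′⊑S → sep S S∈𝒬 f g f∈S (S′⊑S g g∈S′) t ft≡gt)
         ]′ (chain S S′ S∈𝒬 S′∈𝒬)
  ... | F , sep , max with em {P = ∃[ t₀ ] ∀ y → ∃[ f ] T (F f) × f t₀ ≡ y}
  ...   | yes (t₀ , onto) = t₀ , λ t → (λ y → proj₁ (onto y) t) , λ {y} {z} e → let
          (f , f∈ , ft₀≡y) = onto y
          (g , g∈ , gt₀≡z) = onto z
        in ≡.trans (≡.sym ft₀≡y) (≡.trans (cong (λ h → h t₀) (sep f g f∈ g∈ t e)) gt₀≡z)
  -- If no coordinate map is onto, a missed value in each coordinate gives a choice function
  -- differing everywhere from all of `F`, against maximality.
  ...   | no ¬onto = ⊥-elim (max new (λ new∈ → proj₂ (missed i₀) (new , new∈ , ≡.refl)) separated)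
    where
    missed : ∀ t → ∃[ y ] ¬ (∃[ f ] T (F f) × f t ≡ y)
    missed t = ¬∀⇒∃¬ (λ onto → ¬onto (t , onto))

    new : ∀ t → X t
    new t = proj₁ (missed t)

    separated : ∀ f g → T (insert F new f) → T (insert F new g) → ∀ t → f t ≡ g t → f ≡ g
    separated f g f∈ g∈ t e with from⌊⌋ f∈ | from⌊⌋ g∈
    ... | inj₁ f∈F  | inj₁ g∈F  = sep f g f∈F g∈F t e
    ... | inj₁ f∈F  | inj₂ ≡.refl = ⊥-elim (proj₂ (missed t) (f , f∈F , e))
    ... | inj₂ ≡.refl | inj₁ g∈F  = ⊥-elim (proj₂ (missed t) (g , g∈F , ≡.sym e))
    ... | inj₂ ≡.refl | inj₂ ≡.refl = ≡.refl

-- Linear combinations and spans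

module Combinations {r ℓr m ℓm} {k : CommutativeRing r ℓr}
                    (M : LeftModule (CommutativeRing.ring k) m ℓm) where
  private module k = CommutativeRing k
  open LeftModule M
  open LeftModuleProperties M
  open SetoidReasoning ≈ᴹ-setoid

  -1*ₗ : ∀ x → k.- k.1# *ₗ x ≈ᴹ -ᴹ x
  -1*ₗ x = inverseʳ-uniqueᴹ x (k.- k.1# *ₗ x) (begin
    x +ᴹ k.- k.1# *ₗ x            ≈⟨ +ᴹ-congʳ (*ₗ-identityˡ x) ⟨
    k.1# *ₗ x +ᴹ k.- k.1# *ₗ x    ≈⟨ *ₗ-distribʳ x k.1# (k.- k.1#) ⟨
    (k.1# k.+ k.- k.1#) *ₗ x      ≈⟨ *ₗ-cong (k.-‿inverseʳ k.1#) ≈ᴹ-refl ⟩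
    k.0# *ₗ x                     ≈⟨ *ₗ-zeroˡ x ⟩
    0ᴹ                            ∎)

  module _ {y} {Y : Set y} where

    Off : Y → List (k.Carrier × Y) → Set _
    Off z = All (λ (_ , z′) → z′ ≢ z)

    scale : k.Carrier → List (k.Carrier × Y) → List (k.Carrier × Y)
    scale c = map (λ (d , z) → c k.* d , z)

    Off-scale : ∀ {z c l} → Off z l → Off z (scale c l)
    Off-scale off = map⁺ off

    comb : (Y → Carrierᴹ) → List (k.Carrier × Y) → Carrierᴹ
    comb w []            = 0ᴹ
    comb w ((c , z) ∷ l) = c *ₗ w z +ᴹ comb w l

    comb-++ : ∀ w l l′ → comb w (l ++ l′) ≈ᴹ comb w l +ᴹ comb w l′
    comb-++ w []            l′ = ≈ᴹ-sym (+ᴹ-identityˡ _)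
    comb-++ w ((c , z) ∷ l) l′ = ≈ᴹ-trans (+ᴹ-congˡ (comb-++ w l l′)) (≈ᴹ-sym (+ᴹ-assoc _ _ _))

    comb-scale : ∀ w c l → comb w (scale c l) ≈ᴹ c *ₗ comb w l
    comb-scale w c []            = ≈ᴹ-sym (*ₗ-zeroʳ c)
    comb-scale w c ((d , z) ∷ l) = ≈ᴹ-trans
      (+ᴹ-cong (*ₗ-assoc c d (w z)) (comb-scale w c l)) (≈ᴹ-sym (*ₗ-distribˡ c _ _))

    comb-cong : ∀ {w w′} l → All (λ (_ , z) → w z ≡ w′ z) l → comb w l ≡ comb w′ l
    comb-cong []            []       = ≡.refl
    comb-cong ((c , z) ∷ l) (p ∷ ps) = cong₂ (λ a b → c *ₗ a +ᴹ b) p (comb-cong l ps)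

    -- Linear independence when the scalars form a field, normalised so that one generator has
    -- coefficient 1 and does not occur in `l`. The list may repeat generators and have zero
    -- coefficients.
    Independent : (Y → Carrierᴹ) → Set _
    Independent w = ∀ z l → Off z l → ¬ (w z +ᴹ comb w l ≈ᴹ 0ᴹ)

    SpanOff : (Y → Carrierᴹ) → Y → Carrierᴹ → Set _
    SpanOff w z x = ∃[ l ] Off z l × x ≈ᴹ comb w l

    module _ {w : Y → Carrierᴹ} {z : Y} where

      SpanOff-resp : ∀ {x x′} → x ≈ᴹ x′ → SpanOff w z x → SpanOff w z x′
      SpanOff-resp e (l , off , p) = l , off , ≈ᴹ-trans (≈ᴹ-sym e) p

      SpanOff-0 : SpanOff w z 0ᴹ
      SpanOff-0 = [] , [] , ≈ᴹ-refl

      SpanOff-+ : ∀ {x x′} → SpanOff w z x → SpanOff w z x′ → SpanOff w z (x +ᴹ x′)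
      SpanOff-+ (l , off , p) (l′ , off′ , p′) = l ++ l′ , ++⁺ off off′ ,
        ≈ᴹ-trans (+ᴹ-cong p p′) (≈ᴹ-sym (comb-++ w l l′))

      SpanOff-*ₗ : ∀ c {x} → SpanOff w z x → SpanOff w z (c *ₗ x)
      SpanOff-*ₗ c (l , off , p) = scale c l , Off-scale off ,
        ≈ᴹ-trans (*ₗ-cong k.refl p) (≈ᴹ-sym (comb-scale w c l))

      SpanOff-neg : ∀ {x} → SpanOff w z x → SpanOff w z (-ᴹ x)
      SpanOff-neg s = SpanOff-resp (-1*ₗ _) (SpanOff-*ₗ (k.- k.1#) s)

      SpanOff-generator : ∀ {z′} → z′ ≢ z → SpanOff w z (w z′)
      SpanOff-generator {z′} z′≢z = (k.1# , z′) ∷ [] , z′≢z ∷ [] ,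
        ≈ᴹ-sym (≈ᴹ-trans (+ᴹ-identityʳ _) (*ₗ-identityˡ _))

      SpanOff-sum : ∀ {n} (x : Fin n → Carrierᴹ) → (∀ i → SpanOff w z (x i)) →
                    SpanOff w z (RawMonoidDefinitions.sum +ᴹ-rawMonoid x)
      SpanOff-sum {zero}  x s = SpanOff-0
      SpanOff-sum {suc n} x s = SpanOff-+ (s zero) (SpanOff-sum (x ∘ suc) (s ∘ suc))

    Independent⇒∉SpanOff : ∀ {w} → Independent w → ∀ z → ¬ SpanOff w z (w z)
    Independent⇒∉SpanOff ind z s with SpanOff-neg s
    ... | l , off , p = ind z l off (≈ᴹ-trans (+ᴹ-congˡ (≈ᴹ-sym p)) (-ᴹ‿inverseʳ _))

-- Steinitz exchange

module Exchange (em : ∀ {a} → ExcludedMiddle a) (ext : ∀ {a b} → Extensionality a b)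
                {r ℓr m ℓm} {k : CommutativeRing r ℓr} (isField : IsField k)
                (M : LeftModule (CommutativeRing.ring k) m ℓm) where
  private module k = CommutativeRing k
  open LeftModule M
  open LeftModuleProperties M
  open CommutativeSemigroupProperties
    (CommutativeMonoid.commutativeSemigroup +ᴹ-commutativeMonoid) using (x∙yz≈y∙xz)
  open SetoidReasoning ≈ᴹ-setoid
  open Combinations {k = k} M
  open Classical em
  open Cardinals em ext

  module _ {y} {Y : Set y} where

    -- The occurrences of `z` are gathered into one coefficient for all `w` at once, because the
    -- result is used for the family both before and after an exchange.
    collect : ∀ (z z′ : Y) l → Off z′ l → ∃[ d ] ∃[ l′ ] Off z l′ × Off z′ l′ ×
              (∀ w → comb w l ≈ᴹ d *ₗ w z +ᴹ comb w l′)
    collect z z′ [] [] = k.0# , [] , [] , [] , λ w →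
      ≈ᴹ-sym (≈ᴹ-trans (+ᴹ-identityʳ _) (*ₗ-zeroˡ _))
    collect z z′ ((c , t) ∷ l) (t≢z′ ∷ off) with collect z z′ l off | em {P = t ≡ z}
    ... | d , l′ , p , q , e | yes ≡.refl = c k.+ d , l′ , p , q , λ w → begin
      c *ₗ w z +ᴹ comb w l                      ≈⟨ +ᴹ-congˡ (e w) ⟩
      c *ₗ w z +ᴹ (d *ₗ w z +ᴹ comb w l′)       ≈⟨ +ᴹ-assoc _ _ _ ⟨
      (c *ₗ w z +ᴹ d *ₗ w z) +ᴹ comb w l′       ≈⟨ +ᴹ-congʳ (*ₗ-distribʳ (w z) c d) ⟨
      (c k.+ d) *ₗ w z +ᴹ comb w l′             ∎
    ... | d , l′ , p , q , e | no t≢z = d , (c , t) ∷ l′ , t≢z ∷ p , t≢z′ ∷ q , λ w → begin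
      c *ₗ w t +ᴹ comb w l                      ≈⟨ +ᴹ-congˡ (e w) ⟩
      c *ₗ w t +ᴹ (d *ₗ w z +ᴹ comb w l′)       ≈⟨ x∙yz≈y∙xz _ _ _ ⟩
      d *ₗ w z +ᴹ (c *ₗ w t +ᴹ comb w l′)       ∎

    -- A relation normalised at some `t` other than `z` involves `z` with a coefficient `d`. If `d`
    -- is 0, it is a relation of the old family; otherwise it can be solved for the new vector,
    -- which would then lie in the span of the others.
    Independent-update : ∀ {w w′ : Y → Carrierᴹ} {z} → Independent w →
      ¬ SpanOff w z (w′ z) → (∀ {t} → t ≢ z → w t ≡ w′ t) → Independent w′
    Independent-update {w} {w′} {z} ind ∉span agree t l off eq with em {P = t ≡ z}
    ... | yes ≡.refl = ∉span (SpanOff-resp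
            (≈ᴹ-sym (inverseˡ-uniqueᴹ _ _ eq))
            (SpanOff-neg (l , off , ≈ᴹ-sym (≈ᴹ-reflexive (comb-cong l (All.map agree off))))))
    ... | no t≢z with collect z t l off
    ...   | d , l′ , off-z , off-t , e with em {P = d k.≈ k.0#}
    ...     | yes d≈0 = ind t l′ off-t (begin
                w t +ᴹ comb w l′                        ≡⟨ cong₂ _+ᴹ_ (agree t≢z) same ⟩
                w′ t +ᴹ comb w′ l′                      ≈⟨ +ᴹ-congˡ (+ᴹ-identityˡ _) ⟨
                w′ t +ᴹ (0ᴹ +ᴹ comb w′ l′)              ≈⟨ +ᴹ-congˡ (+ᴹ-congʳ (*ₗ-zeroˡ _)) ⟨
                w′ t +ᴹ (k.0# *ₗ w′ z +ᴹ comb w′ l′)    ≈⟨ +ᴹ-congˡ (+ᴹ-congʳ (*ₗ-cong d≈0 ≈ᴹ-refl)) ⟨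
                w′ t +ᴹ (d *ₗ w′ z +ᴹ comb w′ l′)       ≈⟨ +ᴹ-congˡ (e w′) ⟨
                w′ t +ᴹ comb w′ l                       ≈⟨ eq ⟩
                0ᴹ                                      ∎)
              where
              same : comb w l′ ≡ comb w′ l′
              same = comb-cong l′ (All.map agree off-z)
    ...     | no d≉0 = ∉span (SpanOff-resp cancel (SpanOff-*ₗ d⁻¹ (SpanOff-neg
                (SpanOff-+ (SpanOff-generator t≢z) (l′ , off-z , ≈ᴹ-refl)))))
              where
              d⁻¹ : k.Carrier
              d⁻¹ = proj₁ (IsField.invertible isField d d≉0)

              d⁻¹-inverse : d⁻¹ k.* d k.≈ k.1#
              d⁻¹-inverse = proj₁ (proj₂ (IsField.invertible isField d d≉0))

              same : w t +ᴹ comb w l′ ≡ w′ t +ᴹ comb w′ l′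
              same = cong₂ _+ᴹ_ (agree t≢z) (comb-cong l′ (All.map agree off-z))

              solved : d *ₗ w′ z ≈ᴹ -ᴹ (w t +ᴹ comb w l′)
              solved = inverseˡ-uniqueᴹ _ _ (begin
                d *ₗ w′ z +ᴹ (w t +ᴹ comb w l′)     ≡⟨ cong (d *ₗ w′ z +ᴹ_) same ⟩
                d *ₗ w′ z +ᴹ (w′ t +ᴹ comb w′ l′)   ≈⟨ x∙yz≈y∙xz _ _ _ ⟩
                w′ t +ᴹ (d *ₗ w′ z +ᴹ comb w′ l′)   ≈⟨ +ᴹ-congˡ (e w′) ⟨
                w′ t +ᴹ comb w′ l                   ≈⟨ eq ⟩
                0ᴹ                                  ∎)

              cancel : d⁻¹ *ₗ (-ᴹ (w t +ᴹ comb w l′)) ≈ᴹ w′ z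
              cancel = begin
                d⁻¹ *ₗ (-ᴹ (w t +ᴹ comb w l′))   ≈⟨ *ₗ-cong k.refl solved ⟨
                d⁻¹ *ₗ (d *ₗ w′ z)               ≈⟨ *ₗ-assoc d⁻¹ d (w′ z) ⟨
                (d⁻¹ k.* d) *ₗ w′ z              ≈⟨ *ₗ-cong d⁻¹-inverse ≈ᴹ-refl ⟩
                k.1# *ₗ w′ z                     ≈⟨ *ₗ-identityˡ _ ⟩
                w′ z                             ∎

  Spanning : ∀ {x} {X : Set x} → (X → Carrierᴹ) → Set _
  Spanning {X = X} b = ∀ v → ∃[ n ] Σ[ x ∈ (Fin n → X) ] Σ[ c ∈ (Fin n → k.Carrier) ]
    v ≈ᴹ RawMonoidDefinitions.sum +ᴹ-rawMonoid (λ i → c i *ₗ b (x i))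

  module _ {x y} {X : Set x} {Y : Set y} {b : X → Carrierᴹ} (spanning : Spanning b)
           {v : Y → Carrierᴹ} (v-independent : Independent v) where

    -- A maximal partial map R : Y ⇀ X such that replacing v z by b (R z) wherever R is
    -- defined keeps the family independent is total and injective.
    private
      exchangeAt : ∀ (R : Subset (Y × X)) z → Dec (∃[ t ] T (R (z , t))) → Carrierᴹ
      exchangeAt R z (yes (t , _)) = b t
      exchangeAt R z (no _)        = v z

      exchange : Subset (Y × X) → Y → Carrierᴹ
      exchange R z = exchangeAt R z em

      Functional : Subset (Y × X) → Set _
      Functional R = ∀ z t t′ → T (R (z , t)) → T (R (z , t′)) → t ≡ t′

      exchange-defined : ∀ {R} → Functional R → ∀ {z t} → T (R (z , t)) → exchange R z ≡ b t
      exchange-defined {R} fun {z} {t} t∈R = go em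
        where
        go : (d : Dec (∃[ t ] T (R (z , t)))) → exchangeAt R z d ≡ b t
        go (yes (t′ , t′∈R)) = cong b (fun z t′ t t′∈R t∈R)
        go (no ∄t)           = ⊥-elim (∄t (t , t∈R))

      exchange-undefined : ∀ {R z} → ¬ (∃[ t ] T (R (z , t))) → exchange R z ≡ v z
      exchange-undefined {R} {z} ∄t = go em
        where
        go : (d : Dec (∃[ t ] T (R (z , t)))) → exchangeAt R z d ≡ v z
        go (yes ∃t) = ⊥-elim (∄t ∃t)
        go (no _)   = ≡.refl

      exchange-local : ∀ {R R′} → Functional R → Functional R′ → ∀ {z} →
        (∀ t → T (R (z , t)) → T (R′ (z , t))) → (∀ t → T (R′ (z , t)) → T (R (z , t))) →
        exchange R z ≡ exchange R′ z
      exchange-local {R} fun fun′ {z} R⊆R′ R′⊆R with em {P = ∃[ t ] T (R (z , t))}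
      ... | yes (t , t∈R) = ≡.sym (exchange-defined fun′ (R⊆R′ t t∈R))
      ... | no ∄t         = ≡.sym (exchange-undefined (λ (t , t∈R′) → ∄t (t , R′⊆R t t∈R′)))

      Good : Subset (Y × X) → Set _
      Good R = Functional R × Independent (exchange R)

      empty : Subset (Y × X)
      empty _ = false

      empty-good : Good empty
      empty-good = (λ _ _ _ ()) , λ z l off eq → v-independent z l off
        (≈ᴹ-trans (≈ᴹ-reflexive (cong₂ _+ᴹ_ (≡.sym (exchange-undefined {empty} (λ ())))
          (comb-cong l (All.map (λ _ → ≡.sym (exchange-undefined {empty} (λ ()))) off)))) eq)

      chain-closed : ∀ 𝒬 → (∀ R → T (𝒬 R) → Good R) → IsChain 𝒬 → Good (⋃ˢ 𝒬)
      chain-closed 𝒬 good chain = functional , independent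
        where
        functional : Functional (⋃ˢ 𝒬)
        functional z t t′ t∈ t′∈ =
          let (R , R∈𝒬 , t∈R) = from⌊⌋ t∈
              (R′ , R′∈𝒬 , t′∈R′) = from⌊⌋ t′∈
          in [ (λ R⊑R′ → proj₁ (good R′ R′∈𝒬) z t t′ (R⊑R′ _ t∈R) t′∈R′)
             , (λ R′⊑R → proj₁ (good R R∈𝒬) z t t′ t∈R (R′⊑R _ t′∈R′))
             ]′ (chain R R′ R∈𝒬 R′∈𝒬)

        Captures : Subset (Y × X) → Y → Set _
        Captures R z = ∀ t → T (⋃ˢ 𝒬 (z , t)) → T (R (z , t))

        -- A relation meets finitely many indices, and a single member of the chain already contains
        -- all pairs of the union at these. `empty` stands in when there are no such pairs, as when
        -- the chain is empty.
        capture : ∀ l → ∃[ R ] (T (𝒬 R) ⊎ R ≡ empty) × All (Captures R ∘ proj₂ {A = k.Carrier}) l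
        capture [] = empty , inj₂ ≡.refl , []
        capture ((c , z) ∷ l) with capture l | em {P = ∃[ t ] T (⋃ˢ 𝒬 (z , t))}
        ... | R , R∈ , caps | no ∄t = R , R∈ , (λ t t∈ → ⊥-elim (∄t (t , t∈))) ∷ caps
        ... | R , R∈ , caps | yes (t , t∈) with from⌊⌋ t∈
        ...   | R′ , R′∈𝒬 , t∈R′ = extend R∈
          where
          captures : Captures R′ z
          captures t′ t′∈ = subst (λ s → T (R′ (z , s))) (functional z t t′ t∈ t′∈) t∈R′

          extend : T (𝒬 R) ⊎ R ≡ empty →
                   ∃[ R ] (T (𝒬 R) ⊎ R ≡ empty) × All (Captures R ∘ proj₂) ((c , z) ∷ l)
          extend (inj₂ ≡.refl) = R′ , inj₁ R′∈𝒬 , captures ∷ All.map (λ cap t → ⊥-elim ∘ cap t) caps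
          extend (inj₁ R∈𝒬) with chain R R′ R∈𝒬 R′∈𝒬
          ... | inj₁ R⊑R′ = R′ , inj₁ R′∈𝒬 , captures ∷ All.map (λ cap t → R⊑R′ _ ∘ cap t) caps
          ... | inj₂ R′⊑R = R , inj₁ R∈𝒬 , (λ t → R′⊑R _ ∘ captures t) ∷ caps

        independent : Independent (exchange (⋃ˢ 𝒬))
        independent z l off eq with capture ((k.0# , z) ∷ l)
        ... | R , R∈ , cap ∷ caps = proj₂ R-good z l off
                (≈ᴹ-trans (≈ᴹ-reflexive (cong₂ _+ᴹ_ (agree cap) (comb-cong l (All.map agree caps)))) eq)
          where
          R-good : Good R
          R-good = [ good R , (λ where ≡.refl → empty-good) ]′ R∈

          R⊑ : R ⊑ ⋃ˢ 𝒬
          R⊑ = [ ⊑-⋃ˢ , (λ where ≡.refl _ ()) ]′ R∈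

          agree : ∀ {z} → Captures R z → exchange R z ≡ exchange (⋃ˢ 𝒬) z
          agree cap = exchange-local (proj₁ R-good) functional (λ t → R⊑ _) cap

    steinitz : Σ[ φ ∈ (Y → X) ] (∀ {z z′} → φ z ≡ φ z′ → z ≡ z′)
    steinitz with Zorn.maximal Good chain-closed
    ... | R , (functional , independent) , max = proj₁ ∘ total , λ {z} {z′} → injective z z′
      where
      total : ∀ z → ∃[ t ] T (R (z , t))
      -- An unexchanged index still carries `v z`. If every `b t` were in the span of the other
      -- vectors, `v z` would be too, because `b` spans. Hence some `b t` can replace it, against
      -- maximality.
      total z = stable λ ∄t →
        let (t , ∉span) = ¬∀⇒∃¬ {P = λ t → SpanOff (exchange R) z (b t)} λ b∈span →
              let (n , s , c , v≈) = spanning (v z)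
              in Independent⇒∉SpanOff independent z
                   (subst (SpanOff (exchange R) z) (≡.sym (exchange-undefined ∄t))
                     (SpanOff-resp (≈ᴹ-sym v≈)
                       (SpanOff-sum _ (λ i → SpanOff-*ₗ (c i) (b∈span (s i))))))
            R⁺ = insert R (z , t)
            functional⁺ : Functional R⁺
            functional⁺ z₁ t₁ t₂ t₁∈ t₂∈ = unique ∄t (from⌊⌋ t₁∈) (from⌊⌋ t₂∈)
            same : ∀ {z′} → z′ ≢ z → exchange R z′ ≡ exchange R⁺ z′
            same z′≢z = exchange-local functional functional⁺ (λ t′ → to⌊⌋ ∘ inj₁)
              (λ t′ t′∈ → [ id , (λ e → ⊥-elim (z′≢z (cong proj₁ e))) ]′ (from⌊⌋ t′∈))
        in max (z , t) (λ t∈R → ∄t (t , t∈R))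
             (functional⁺ ,
              Independent-update independent
                (∉span ∘ subst (SpanOff (exchange R) z)
                  (exchange-defined functional⁺ (to⌊⌋ (inj₂ ≡.refl))))
                same)
        where
        unique : ∀ {z t} → ¬ (∃[ t ] T (R (z , t))) → ∀ {z₁ t₁ t₂} →
                 T (R (z₁ , t₁)) ⊎ (z₁ , t₁) ≡ (z , t) → T (R (z₁ , t₂)) ⊎ (z₁ , t₂) ≡ (z , t) →
                 t₁ ≡ t₂
        unique _  (inj₁ p)    (inj₁ q)    = functional _ _ _ p q
        unique ∄t (inj₁ p)    (inj₂ ≡.refl) = ⊥-elim (∄t (_ , p))
        unique ∄t (inj₂ ≡.refl) (inj₁ q)    = ⊥-elim (∄t (_ , q))
        unique _  (inj₂ ≡.refl) (inj₂ ≡.refl) = ≡.refl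

      injective : ∀ z z′ → proj₁ (total z) ≡ proj₁ (total z′) → z ≡ z′
      -- Two indices sent to the same element of `X` would carry the same vector, which independence
      -- forbids.
      injective z z′ e = stable λ z≢z′ →
        Independent⇒∉SpanOff independent z (subst (SpanOff (exchange R) z) same
          (SpanOff-generator (z≢z′ ∘ ≡.sym)))
        where
        same : exchange R z′ ≡ exchange R z
        same = ≡.trans (exchange-defined functional (proj₂ (total z′)))
          (≡.trans (cong b (≡.sym e)) (≡.sym (exchange-defined functional (proj₂ (total z)))))

  dependent : ∀ {x y} {X : Set x} {Y : Set y} {b : X → Carrierᴹ} → Spanning b →
    ¬ (Σ[ φ ∈ (Y → X) ] (∀ {z z′} → φ z ≡ φ z′ → z ≡ z′)) → ∀ (v : Y → Carrierᴹ) →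
    ∃[ z ] ∃[ l ] Off z l × v z +ᴹ comb v l ≈ᴹ 0ᴹ
  dependent {b = b} spanning Y⋠X v = stable λ ¬∃ →
    Y⋠X (steinitz {b = b} spanning (λ z l off eq → ¬∃ (z , l , off , eq)))

-- Finite exceptional sets

FinitelyMany : ∀ {a p} {X : Set a} → Pred X p → Set _
FinitelyMany P = ∃[ xs ] ∀ x → P x → x ∈ xs

finitelyMany-⊆ : ∀ {a p q} {X : Set a} {P : Pred X p} {Q : Pred X q} →
                 (∀ x → P x → Q x) → FinitelyMany Q → FinitelyMany P
finitelyMany-⊆ P⊆Q (xs , cover) = xs , λ x → cover x ∘ P⊆Q x

finitelyMany-∪ : ∀ {a p q} {X : Set a} {P : Pred X p} {Q : Pred X q} →
                 FinitelyMany P → FinitelyMany Q → FinitelyMany (λ x → P x ⊎ Q x)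
finitelyMany-∪ (xs , coverP) (ys , coverQ) = xs ++ ys , λ x →
  [ ∈-++⁺ˡ ∘ coverP x , ∈-++⁺ʳ xs ∘ coverQ x ]′

finitelyMany-Any : ∀ {a b p} {X : Set a} {Y : Set b} {P : Y → Pred X p} →
                   (∀ y → FinitelyMany (P y)) → ∀ ys → FinitelyMany (λ x → Any (λ y → P y x) ys)
finitelyMany-Any fin []       = [] , λ _ ()
finitelyMany-Any fin (y ∷ ys) = finitelyMany-⊆
  (λ { _ (here p) → inj₁ p ; _ (there p) → inj₂ p })
  (finitelyMany-∪ (fin y) (finitelyMany-Any fin ys))

finitelyMany-< : ∀ m → FinitelyMany (ℕ._< m)
finitelyMany-< m = upTo m , λ _ → ∈-upTo⁺

fresh : ∀ xs → ∃[ n ] n ∉ xs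
fresh xs = suc (ListAction.sum xs) , λ n∈ → ℕ.<-irrefl ≡.refl (∈⇒≤sum n∈)
  where
  ∈⇒≤sum : ∀ {x xs} → x ∈ xs → x ℕ.≤ ListAction.sum xs
  ∈⇒≤sum {x} (here ≡.refl) = ℕ.m≤m+n x _
  ∈⇒≤sum {xs = y ∷ _} (there x∈) = ℕ.≤-trans (∈⇒≤sum x∈) (ℕ.m≤n+m _ y)

-- Arithmetic in the field and the family of reciprocals

module FiniteZeros (em : ∀ {a} → ExcludedMiddle a) (ext : ∀ {a b} → Extensionality a b)
                   {r ℓr} {k : CommutativeRing r ℓr} (isField : IsField k) where
  open CommutativeRing k
  open IsField isField
  open RingProperties ring using (+-cancelʳ; -‿distribˡ-*; -‿involutive; -1*x≈-x; x∙y⁻¹≈ε⇒x≈y)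
  open SetoidReasoning setoid
  open Classical em

  unitModule : LeftModule ring r ℓr
  unitModule = TensorUnit.leftModule {R = ring}

  open Combinations {k = k} unitModule public

  finitelyMany-unique : ∀ {a p} {X : Set a} {P : Pred X p} →
                        (∀ {x y} → P x → P y → x ≡ y) → FinitelyMany P
  finitelyMany-unique {P = P} unique with em {P = ∃ P}
  ... | yes (x , Px) = x ∷ [] , λ y Py → here (unique Py Px)
  ... | no ∄x        = [] , λ x Px → ⊥-elim (∄x (x , Px))

  inverse : ∀ x → Dec (x ≈ 0#) → Carrier
  inverse x (yes _)  = 0#
  inverse x (no x≉0) = proj₁ (invertible x x≉0)

  infix 8 _⁻¹
  _⁻¹ : Carrier → Carrier
  x ⁻¹ = inverse x em

  ⁻¹-inverseˡ : ∀ {x} → ¬ (x ≈ 0#) → x ⁻¹ * x ≈ 1#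
  ⁻¹-inverseˡ {x} x≉0 = go em
    where
    go : (d : Dec (x ≈ 0#)) → inverse x d * x ≈ 1#
    go (yes x≈0) = ⊥-elim (x≉0 x≈0)
    go (no x≉0)  = proj₁ (proj₂ (invertible x x≉0))

  *-cancelʳ-nonZero : ∀ {x y z} → ¬ (z ≈ 0#) → x * z ≈ y * z → x ≈ y
  *-cancelʳ-nonZero {x} {y} {z} z≉0 xz≈yz = begin
    x              ≈⟨ expand x ⟩
    x * z * z ⁻¹   ≈⟨ *-congʳ xz≈yz ⟩
    y * z * z ⁻¹   ≈⟨ expand y ⟨
    y              ∎
    where
    expand : ∀ w → w ≈ w * z * z ⁻¹
    expand w = begin
      w                ≈⟨ *-identityʳ w ⟨
      w * 1#           ≈⟨ *-congˡ (⁻¹-inverseˡ z≉0) ⟨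
      w * (z ⁻¹ * z)   ≈⟨ *-congˡ (*-comm _ _) ⟩
      w * (z * z ⁻¹)   ≈⟨ *-assoc _ _ _ ⟨
      w * z * z ⁻¹     ∎

  *-nonZero : ∀ {x y} → ¬ (x ≈ 0#) → ¬ (y ≈ 0#) → ¬ (x * y ≈ 0#)
  *-nonZero x≉0 y≉0 xy≈0 = x≉0 (*-cancelʳ-nonZero y≉0 (trans xy≈0 (sym (zeroˡ _))))

  *-nonZero⇒≈0 : ∀ {x y} → ¬ (x ≈ 0#) → x * y ≈ 0# → y ≈ 0#
  *-nonZero⇒≈0 x≉0 xy≈0 = stable λ y≉0 → *-nonZero x≉0 y≉0 xy≈0

  ⁻¹-nonZero : ∀ {x} → ¬ (x ≈ 0#) → ¬ (x ⁻¹ ≈ 0#)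
  ⁻¹-nonZero x≉0 x⁻¹≈0 = 1≉0 (trans (sym (⁻¹-inverseˡ x≉0)) (trans (*-congʳ x⁻¹≈0) (zeroˡ _)))

  ⁻¹-injective : ∀ {x y} → ¬ (x ≈ 0#) → ¬ (y ≈ 0#) → x ⁻¹ ≈ y ⁻¹ → x ≈ y
  ⁻¹-injective x≉0 y≉0 e = *-cancelʳ-nonZero (⁻¹-nonZero x≉0) (begin
    _ * _ ⁻¹   ≈⟨ *-comm _ _ ⟩
    _ ⁻¹ * _   ≈⟨ ⁻¹-inverseˡ x≉0 ⟩
    1#         ≈⟨ ⁻¹-inverseˡ y≉0 ⟨
    _ ⁻¹ * _   ≈⟨ *-congʳ e ⟨
    _ ⁻¹ * _   ≈⟨ *-comm _ _ ⟩
    _ * _ ⁻¹   ∎)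

  private
    module S = SemiringSolver commutativeSemiring
    open S using (_:+_; _:*_; _:=_)

  comb-linear : ∀ {y} {Y : Set y} d e f {w w₁ w₂ : Y → Carrier} l →
    All (λ (_ , z) → d * w z ≈ e * w₁ z + f * w₂ z) l →
    d * comb w l ≈ e * comb w₁ l + f * comb w₂ l
  comb-linear d e f [] [] = trans (zeroʳ d)
    (sym (trans (+-cong (zeroʳ e) (zeroʳ f)) (+-identityˡ 0#)))
  comb-linear d e f {w} {w₁} {w₂} ((c , z) ∷ l) (p ∷ ps) = begin
    d * (c * w z + comb w l)
      ≈⟨ S.solve 4 (λ d c a b → d :* (c :* a :+ b) := c :* (d :* a) :+ d :* b) refl d c (w z) _ ⟩
    c * (d * w z) + d * comb w l
      ≈⟨ +-cong (*-congˡ p) (comb-linear d e f l ps) ⟩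
    c * (e * w₁ z + f * w₂ z) + (e * comb w₁ l + f * comb w₂ l)
      ≈⟨ S.solve 7 (λ c e f a₁ a₂ b₁ b₂ →
           c :* (e :* a₁ :+ f :* a₂) :+ (e :* b₁ :+ f :* b₂) :=
           e :* (c :* a₁ :+ b₁) :+ f :* (c :* a₂ :+ b₂))
         refl c e f (w₁ z) (w₂ z) (comb w₁ l) (comb w₂ l) ⟩
    e * (c * w₁ z + comb w₁ l) + f * (c * w₂ z + comb w₂ l) ∎

  comb-map : ∀ {y z} {Y : Set y} {Z : Set z} (g : Y → Z) w (l : List (Carrier × Y)) →
    comb w (map (λ (c , y) → c , g y) l) ≡ comb (w ∘ g) l
  comb-map g w []            = ≡.refl
  comb-map g w ((c , z) ∷ l) = ≡.cong (c * w (g z) +_) (comb-map g w l)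

  comb-weight : ∀ {y} {Y : Set y} (g : Y → Carrier) w (l : List (Carrier × Y)) →
    comb w (map (λ (c , z) → c * g z , z) l) ≈ comb (λ z → g z * w z) l
  comb-weight g w []            = refl
  comb-weight g w ((c , z) ∷ l) = +-cong (*-assoc c (g z) (w z)) (comb-weight g w l)

  comb-zero : ∀ {y} {Y : Set y} {w : Y → Carrier} l → All (λ (_ , z) → w z ≈ 0#) l → comb w l ≈ 0#
  comb-zero []            []       = refl
  comb-zero ((c , z) ∷ l) (p ∷ ps) =
    trans (+-cong (trans (*-congˡ p) (zeroʳ c)) (comb-zero l ps)) (+-identityˡ 0#)

  -- The combinations have the shape that `dependent` produces, with coefficient 1 at `z` and the
  -- rest off `z`, so every dependence among images yields a kernel element with finitely many
  -- zeros.
  HasFiniteZeros : ∀ {s y} {S : Set s} {Y : Set y} → (Y → S → Carrier) → Set _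
  HasFiniteZeros u = ∀ z l → Off z l → FinitelyMany (λ t → u z t + comb (λ z′ → u z′ t) l ≈ 0#)

  module Cauchy {s y} {S : Set s} {Y : Set y}
                (τ : Y → Carrier) (τ-injective : ∀ {z z′} → τ z ≈ τ z′ → z ≡ z′)
                (t : S → Carrier) (t-injective : ∀ {x x′} → t x ≈ t x′ → x ≡ x′) where

    -- At a pole the value is 0 by the convention on `_⁻¹`. Each `z` has at most one pole, and poles
    -- are set apart as exceptional points.
    reciprocal : Y → S → Carrier
    reciprocal z x = (τ z - t x) ⁻¹

    Regular : S → Y → Set _
    Regular x z = ¬ (τ z - t x ≈ 0#)

    finitely-irregular : ∀ z → FinitelyMany (λ x → ¬ Regular x z)
    finitely-irregular z = finitelyMany-unique λ p q → t-injective
        (trans (sym (x∙y⁻¹≈ε⇒x≈y _ _ (stable p))) (x∙y⁻¹≈ε⇒x≈y _ _ (stable q)))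

    -- 1/(τ − x) − 1/(τ − x₀) = (x − x₀)/((τ − x)(τ − x₀))
    difference : ∀ {x x₀ z} → Regular x z → Regular x₀ z →
      (t x - t x₀) * (reciprocal z x₀ * reciprocal z x) ≈
      1# * reciprocal z x + - 1# * reciprocal z x₀
    difference {x} {x₀} {z} reg reg₀ = *-cancelʳ-nonZero reg (*-cancelʳ-nonZero reg₀ (begin
      (t x - t x₀) * (q * p) * A * A₀
        ≈⟨ S.solve 5 (λ δ q p A A₀ → δ :* (q :* p) :* A :* A₀ := δ :* (p :* A) :* (q :* A₀))
             refl (t x - t x₀) q p A A₀ ⟩
      (t x - t x₀) * (p * A) * (q * A₀)
        ≈⟨ *-cong (*-congˡ (⁻¹-inverseˡ reg)) (⁻¹-inverseˡ reg₀) ⟩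
      (t x - t x₀) * 1# * 1#
        ≈⟨ trans (*-identityʳ _) (*-identityʳ _) ⟩
      t x - t x₀
        ≈⟨ +-identityˡ _ ⟨
      0# + (t x - t x₀)
        ≈⟨ +-congʳ (-‿inverseʳ (τ z)) ⟨
      (τ z - τ z) + (t x - t x₀)
        ≈⟨ +-cong (+-congˡ (sym (-1*x≈-x _))) (+-congʳ (sym (trans (-1*x≈-x _) (-‿involutive (t x))))) ⟩
      (τ z + ε * τ z) + (ε * - t x - t x₀)
        ≈⟨ S.solve 4 (λ τ e n n₀ → (τ :+ e :* τ) :+ (e :* n :+ n₀) := (τ :+ n₀) :+ e :* (τ :+ n))
             refl (τ z) ε (- t x) (- t x₀) ⟩
      A₀ + ε * A
        ≈⟨ +-cong (trans (*-identityˡ _) (*-identityˡ _)) (trans (*-identityʳ _) (*-identityʳ _)) ⟨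
      1# * (1# * A₀) + ε * A * 1# * 1#
        ≈⟨ +-cong (*-congˡ (*-congʳ (⁻¹-inverseˡ reg))) (*-congʳ (*-congˡ (⁻¹-inverseˡ reg₀))) ⟨
      1# * ((p * A) * A₀) + ε * A * (q * A₀) * 1#
        ≈⟨ +-congˡ (*-identityʳ _) ⟩
      1# * ((p * A) * A₀) + ε * A * (q * A₀)
        ≈⟨ S.solve 6 (λ o e p q A A₀ → o :* ((p :* A) :* A₀) :+ e :* A :* (q :* A₀)
              := (o :* p :+ e :* q) :* A :* A₀)
             refl 1# ε p q A A₀ ⟩
      (1# * p + ε * q) * A * A₀ ∎))
      where
      ε A A₀ p q : Carrier
      ε = - 1#
      A  = τ z - t x
      A₀ = τ z - t x₀
      p  = reciprocal z x
      q  = reciprocal z x₀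

    -- If F = Σ βᵢ/(τᵢ − t) vanishes at t₀, then at its other zeros Σ βᵢ/((τᵢ − t₀)(τᵢ − t))
    -- vanishes as well, and a combination of the two sums has one term less.
    finite-zeros : ∀ n β → ¬ (β ≈ 0#) → ∀ z l → length l ≡ n → Off z l →
      FinitelyMany (λ x → comb (λ z′ → reciprocal z′ x) ((β , z) ∷ l) ≈ 0#)
    finite-zeros _ β β≉0 z [] _ [] = finitelyMany-⊆
      (λ x F≈0 reg → *-nonZero β≉0 (⁻¹-nonZero reg) (trans (sym (+-identityʳ _)) F≈0))
      (finitely-irregular z)
    finite-zeros (suc n) β β≉0 z ((γ , z₁) ∷ l) len (z₁≢z ∷ off) with
      em {P = ∃[ x₀ ] All (Regular x₀ ∘ proj₂) ((β , z) ∷ (γ , z₁) ∷ l) ×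
              comb (λ z′ → reciprocal z′ x₀) ((β , z) ∷ (γ , z₁) ∷ l) ≈ 0#}
    ... | no ∄x₀ = finitelyMany-⊆
            (λ x F≈0 → ¬All⇒Any¬ (λ _ → em) _ λ reg → ∄x₀ (x , reg , F≈0))
            (finitelyMany-Any (finitely-irregular ∘ proj₂) ((β , z) ∷ (γ , z₁) ∷ l))
    ... | yes (x₀ , reg₀@(reg₀-z ∷ reg₀-z₁ ∷ reg₀-l) , F₀≈0) = finitelyMany-⊆
            (λ x F≈0 → cases x F≈0)
            (finitelyMany-∪ (finitelyMany-unique λ p q → ≡.trans p (≡.sym q))
              (finitelyMany-∪ (finitelyMany-Any (finitely-irregular ∘ proj₂) L)
                (finite-zeros n (β * g z) (*-nonZero β≉0 gz≉0) z
                  (map (λ (c , z) → c * g z , z) l)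
                  (≡.trans (length-map _ l) (ℕ.suc-injective len)) (map⁺ off))))
      where
      L = (β , z) ∷ (γ , z₁) ∷ l

      -- The weights belong to 1/(τ z₁ - t x₀) times the given sum minus the product sum. They
      -- vanish at `z₁` by design but not at `z`, so the leading coefficient stays nonzero, which is
      -- all that the induction asks of the coefficients.
      g : Y → Carrier
      g z′ = reciprocal z₁ x₀ - reciprocal z′ x₀

      gz≉0 : ¬ (g z ≈ 0#)
      gz≉0 g≈0 = z₁≢z (τ-injective (+-cancelʳ _ _ _
        (⁻¹-injective reg₀-z₁ reg₀-z (x∙y⁻¹≈ε⇒x≈y _ _ g≈0))))

      module _ x (F≈0 : comb (λ z′ → reciprocal z′ x) L ≈ 0#)
                 (x≢x₀ : x ≢ x₀) (reg : All (Regular x ∘ proj₂) L) where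

        product≈0 : comb (λ z′ → reciprocal z′ x₀ * reciprocal z′ x) L ≈ 0#
        product≈0 = *-nonZero⇒≈0 (λ e → x≢x₀ (t-injective (x∙y⁻¹≈ε⇒x≈y _ _ e))) (begin
          (t x - t x₀) * comb (λ z′ → reciprocal z′ x₀ * reciprocal z′ x) L
            ≈⟨ comb-linear _ 1# (- 1#) L (All.zipWith (λ (p , q) → difference p q) (reg , reg₀)) ⟩
          1# * comb (λ z′ → reciprocal z′ x) L + - 1# * comb (λ z′ → reciprocal z′ x₀) L
            ≈⟨ +-cong (trans (*-congˡ F≈0) (zeroʳ _)) (trans (*-congˡ F₀≈0) (zeroʳ _)) ⟩
          0# + 0#
            ≈⟨ +-identityˡ 0# ⟩
          0# ∎)

        weighted≈0 : comb (λ z′ → g z′ * reciprocal z′ x) L ≈ 0#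
        weighted≈0 = begin
          comb (λ z′ → g z′ * reciprocal z′ x) L
            ≈⟨ *-identityˡ _ ⟨
          1# * comb (λ z′ → g z′ * reciprocal z′ x) L
            ≈⟨ comb-linear 1# (reciprocal z₁ x₀) (- 1#) L (All.map (λ _ → split _) reg) ⟩
          reciprocal z₁ x₀ * comb (λ z′ → reciprocal z′ x) L +
            - 1# * comb (λ z′ → reciprocal z′ x₀ * reciprocal z′ x) L
            ≈⟨ +-cong (trans (*-congˡ F≈0) (zeroʳ _)) (trans (*-congˡ product≈0) (zeroʳ _)) ⟩
          0# + 0#
            ≈⟨ +-identityˡ 0# ⟩
          0# ∎
          where
          split : ∀ z′ → 1# * (g z′ * reciprocal z′ x) ≈
                  reciprocal z₁ x₀ * reciprocal z′ x + - 1# * (reciprocal z′ x₀ * reciprocal z′ x)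
          split z′ = trans (*-identityˡ _) (trans (distribʳ _ _ _)
            (+-congˡ (trans (sym (-‿distribˡ-* _ _)) (sym (-1*x≈-x _)))))

        dropped : comb (λ z′ → reciprocal z′ x)
                    ((β * g z , z) ∷ map (λ (c , z) → c * g z , z) l) ≈ 0#
        dropped = begin
          β * g z * reciprocal z x + comb (λ z′ → reciprocal z′ x) (map (λ (c , z) → c * g z , z) l)
            ≈⟨ +-cong (*-assoc _ _ _) (comb-weight g _ l) ⟩
          β * (g z * reciprocal z x) + comb (λ z′ → g z′ * reciprocal z′ x) l
            ≈⟨ +-congˡ (trans (+-congʳ (trans (*-congˡ
                 (trans (*-congʳ (-‿inverseʳ _)) (zeroˡ _))) (zeroʳ γ))) (+-identityˡ _)) ⟨
          β * (g z * reciprocal z x) +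
            (γ * (g z₁ * reciprocal z₁ x) + comb (λ z′ → g z′ * reciprocal z′ x) l)
            ≈⟨ weighted≈0 ⟩
          0# ∎

      cases : ∀ x → comb (λ z′ → reciprocal z′ x) L ≈ 0# →
              x ≡ x₀ ⊎ (Any (λ cz → ¬ Regular x (proj₂ cz)) L ⊎
              comb (λ z′ → reciprocal z′ x) ((β * g z , z) ∷ map (λ (c , z) → c * g z , z) l) ≈ 0#)
      cases x F≈0 with em {P = x ≡ x₀} | em {P = All (Regular x ∘ proj₂) L}
      ... | yes x≡x₀ | _       = inj₁ x≡x₀
      ... | no x≢x₀  | no ¬reg = inj₂ (inj₁ (¬All⇒Any¬ (λ _ → em) _ ¬reg))
      ... | no x≢x₀  | yes reg = inj₂ (inj₂ (dropped x F≈0 x≢x₀ reg))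

    hasFiniteZeros : HasFiniteZeros reciprocal
    hasFiniteZeros z l off = finitelyMany-⊆
      (λ x → trans (+-congʳ (*-identityˡ _)))
      (finite-zeros (length l) 1# 1≉0 z l ≡.refl off)

-- The binary tree and its generic branch functions

prefix : ∀ n → (ℕ → Bool) → Vec Bool n
prefix zero    s = []
-- The newest digit comes first, so the tail of a node is its parent.
prefix (suc n) s = s n ∷ prefix n s

prefix-≢-mono : ∀ {m n s s′} → m ℕ.≤ n → prefix m s ≢ prefix m s′ → prefix n s ≢ prefix n s′
prefix-≢-mono {n = zero}  ℕ.z≤n ne = ne
prefix-≢-mono {n = suc n} m≤1+n ne e with ℕ.m≤n⇒m<n∨m≡n m≤1+n
... | inj₁ m≤n     = prefix-≢-mono (ℕ.s≤s⁻¹ m≤n) ne (Vec.∷-injectiveʳ e)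
... | inj₂ ≡.refl  = ne e

nodes : ∀ n → List (Vec Bool n)
nodes zero    = [] ∷ []
nodes (suc n) = cartesianProductWith _∷_ (true ∷ false ∷ []) (nodes n)

∈-nodes : ∀ {n} (σ : Vec Bool n) → σ ∈ nodes n
∈-nodes []          = here ≡.refl
∈-nodes (true ∷ σ)  = ∈-cartesianProductWith⁺ _∷_ {xs = true ∷ false ∷ []} (here ≡.refl) (∈-nodes σ)
∈-nodes (false ∷ σ) = ∈-cartesianProductWith⁺ _∷_ {xs = true ∷ false ∷ []}
  (there (here ≡.refl)) (∈-nodes σ)

words : ∀ {a} {X : Set a} → List X → ℕ → List (List X)
words xs zero    = [] ∷ []
words xs (suc n) = [] ∷ cartesianProductWith _∷_ xs (words xs n)

∈-words : ∀ {a} {X : Set a} {xs : List X} {l n} → All (_∈ xs) l → length l ℕ.≤ n → l ∈ words xs n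
∈-words {n = zero}  []       _   = here ≡.refl
∈-words {n = suc n} []       _   = here ≡.refl
∈-words {n = suc n} (p ∷ ps) len =
  there (∈-cartesianProductWith⁺ _∷_ p (∈-words ps (ℕ.s≤s⁻¹ len)))

module Tree (em : ∀ {a} → ExcludedMiddle a) (ext : ∀ {a b} → Extensionality a b)
            {r ℓr} {k : CommutativeRing r ℓr} (isField : IsField k)
            (t : ℕ → CommutativeRing.Carrier k)
            (t-injective : ∀ {m n} → CommutativeRing._≈_ k (t m) (t n) → m ≡ n) where
  open CommutativeRing k
  open IsField isField
  open RingProperties ring using (+-cancelˡ; -1*x≈-x)
  open SetoidReasoning setoid
  open Classical em
  open FiniteZeros em ext isField
  private
    module S = SemiringSolver commutativeSemiring
    open S using (_:+_; _:*_; _:=_)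

  -- A formal combination of points of `V`, standing for the linear functional that sends `q` in k^V
  -- to `comb q φ`.
  Functional : ∀ {v} → Set v → Set _
  Functional V = List (Carrier × V)

  NonZero : ∀ {v} {V : Set v} → Functional V → Set _
  NonZero {V = V} φ = Σ[ q ∈ (V → Carrier) ] ¬ (comb q φ ≈ 0#)

  module _ {v} {V : Set v} where

    comb-line : ∀ c (p q : V → Carrier) φ →
                comb (λ σ → p σ + c * q σ) φ ≈ comb p φ + c * comb q φ
    comb-line c p q φ = begin
      comb (λ σ → p σ + c * q σ) φ        ≈⟨ *-identityˡ _ ⟨
      1# * comb (λ σ → p σ + c * q σ) φ   ≈⟨ comb-linear 1# 1# c φ (All.tabulate λ _ →
                                              trans (*-identityˡ _) (+-congʳ (sym (*-identityˡ _)))) ⟩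
      1# * comb p φ + c * comb q φ        ≈⟨ +-congʳ (*-identityˡ _) ⟩
      comb p φ + c * comb q φ             ∎

    module _ (p q : V → Carrier) where

      Bad : Functional V → ℕ → Set _
      Bad φ n = comb p φ + t n * comb q φ ≈ 0# × ¬ (comb p φ ≈ 0# × comb q φ ≈ 0#)

      -- Along the line p + c q the functional is affine in `c`. Unless it vanishes identically it
      -- has at most one root, and `t` takes that value at most once.
      finitely-bad : ∀ φ → FinitelyMany (Bad φ)
      finitely-bad φ = finitelyMany-unique λ {m} {n} (bad-m , ¬both) (bad-n , _) →
        let equal = +-cancelˡ _ _ _ (trans bad-m (sym bad-n))
            q≉0 q≈0 = ¬both (trans (sym (+-identityʳ _))
                (trans (+-congˡ (sym (trans (*-congˡ q≈0) (zeroʳ (t m))))) bad-m) , q≈0)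
        in t-injective (*-cancelʳ-nonZero q≉0 equal)

    -- Off the zeros of φ₁, …, φᵢ, a generic point of a line also avoids those of φᵢ₊₁.
    avoid : (Φ : List (Functional V)) →
            Σ[ p ∈ (V → Carrier) ] ∀ {φ} → φ ∈ Φ → NonZero φ → ¬ (comb p φ ≈ 0#)
    avoid [] = (λ _ → 0#) , λ ()
    avoid (φ ∷ Φ) with avoid Φ | em {P = NonZero φ}
    ... | p , avoids | no zero-φ = p , λ
      { (here ≡.refl) φ≉0 → ⊥-elim (zero-φ φ≉0) ; (there φ∈) → avoids φ∈ }
    ... | p , avoids | yes (q , q≉0) with finitelyMany-Any (finitely-bad p q) (φ ∷ Φ)
    ...   | bad , covers with fresh bad
    ...     | n , n∉bad = (λ σ → p σ + t n * q σ) , avoids⁺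
      where
      avoids⁺ : ∀ {ψ} → ψ ∈ φ ∷ Φ → NonZero ψ → ¬ (comb (λ σ → p σ + t n * q σ) ψ ≈ 0#)
      avoids⁺ (here ≡.refl) _ e = n∉bad (covers n (here
        (trans (sym (comb-line (t n) p q φ)) e , q≉0 ∘ proj₂)))
      avoids⁺ {ψ} (there ψ∈) ψ≉0 e = n∉bad (covers n (there (Any.map
        (λ { ≡.refl → trans (sym (comb-line (t n) p q ψ)) e , avoids ψ∈ ψ≉0 ∘ proj₁ }) ψ∈)))

  -- `avoid` demands a finite list, hence the bound `n` on the number of terms; any given
  -- combination meets it from some level on.
  functionals : ∀ n → List Carrier → List (Functional (Vec Bool n))
  functionals n C = words (cartesianProduct C (nodes n)) n

  -- The coefficients in coefficients (suc n) are those which elimination with the n-th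
  -- level can produce, and generic n makes every functional at level n that has such
  -- coefficients nonzero, if possible.
  values : ∀ n → List Carrier → List Carrier
  values n C = map (comb (proj₁ (avoid (functionals n C)))) (functionals n C)

  coefficients : ℕ → List Carrier
  coefficients zero    = 1# ∷ []
  coefficients (suc n) = C ++ cartesianProductWith _*_ (D ++ map (- 1# *_) D) C
    where
    C = coefficients n
    D = values n C

  generic : ∀ n → Vec Bool n → Carrier
  generic n = proj₁ (avoid (functionals n (coefficients n)))

  branch : (ℕ → Bool) → ℕ → Carrier
  branch s n = generic n (prefix n s)

  private
    Y = ℕ → Bool

  eval : Functional Y → ℕ → Carrier
  eval Φ n = comb (λ s → branch s n) Φ

  Known : ℕ → Functional Y → Set _
  Known n = All (λ (c , _) → c ∈ coefficients n)

  atLevel : ∀ n → Functional Y → Functional (Vec Bool n)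
  atLevel n = map (λ (c , s) → c , prefix n s)

  atLevel∈functionals : ∀ {n Φ} → Known n Φ → length Φ ℕ.≤ n →
                        atLevel n Φ ∈ functionals n (coefficients n)
  atLevel∈functionals {n} {Φ} known len = ∈-words
    (map⁺ (All.map (λ c∈ → ∈-cartesianProduct⁺ c∈ (∈-nodes _)) known))
    (ℕ.≤-trans (ℕ.≤-reflexive (length-map _ Φ)) len)

  eval-generic : ∀ Φ n → comb (generic n) (atLevel n Φ) ≡ eval Φ n
  eval-generic Φ n = comb-map (prefix n) (generic n) Φ

  eval-nonZero : ∀ {n Φ} → Known n Φ → length Φ ℕ.≤ n → NonZero (atLevel n Φ) → ¬ (eval Φ n ≈ 0#)
  eval-nonZero {n} {Φ} known len nonZero e = proj₂ (avoid (functionals n (coefficients n)))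
    (atLevel∈functionals known len) nonZero (trans (reflexive (eval-generic Φ n)) e)

  eval∈values : ∀ {n Φ} → Known n Φ → length Φ ℕ.≤ n → eval Φ n ∈ values n (coefficients n)
  eval∈values {n} {Φ} known len = subst (_∈ _) (eval-generic Φ n)
    (∈-map⁺ _ (atLevel∈functionals known len))

  coefficients-mono : ∀ {m n c} → m ℕ.≤ n → c ∈ coefficients m → c ∈ coefficients n
  coefficients-mono {n = zero}  ℕ.z≤n c∈ = c∈
  coefficients-mono {n = suc n} m≤1+n c∈ with ℕ.m≤n⇒m<n∨m≡n m≤1+n
  ... | inj₁ m≤n    = ∈-++⁺ˡ (coefficients-mono (ℕ.s≤s⁻¹ m≤n) c∈)
  ... | inj₂ ≡.refl = c∈

  value*coefficient : ∀ {n a c} → a ∈ values n (coefficients n) → c ∈ coefficients n →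
                      a * c ∈ coefficients (suc n)
  value*coefficient {n} a∈ c∈ = ∈-++⁺ʳ (coefficients n) (∈-cartesianProductWith⁺ _*_ (∈-++⁺ˡ a∈) c∈)

  -value*coefficient : ∀ {n a c} → a ∈ values n (coefficients n) → c ∈ coefficients n →
                       (- 1# * a) * c ∈ coefficients (suc n)
  -value*coefficient {n} a∈ c∈ = ∈-++⁺ʳ (coefficients n)
    (∈-cartesianProductWith⁺ _*_ (∈-++⁺ʳ (values n (coefficients n)) (∈-map⁺ (- 1# *_) a∈)) c∈)

  -- The combination of `Φ` and `Ψ` that evaluates to 0 at level `n`; its coefficients are products
  -- of the kind collected in `coefficients (suc n)`.
  eliminate : ℕ → Functional Y → Functional Y → Functional Y
  eliminate n Φ Ψ = scale (eval Φ n) Ψ ++ scale (- 1# * eval Ψ n) Φ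

  eval-scale-++ : ∀ a b Φ Ψ n → eval (scale a Φ ++ scale b Ψ) n ≈ a * eval Φ n + b * eval Ψ n
  eval-scale-++ a b Φ Ψ n = trans (comb-++ _ (scale a Φ) _)
    (+-cong (comb-scale _ a Φ) (comb-scale _ b Ψ))

  -- Two layers separate the scalars `α`, of which nothing is known, from the functionals `Φ`, whose
  -- coefficients are to come from the finite lists.
  total : List (Carrier × Functional Y) → ℕ → Carrier
  total []            n = 0#
  total ((α , Φ) ∷ Γ) n = α * eval Φ n + total Γ n

  total-eliminate : ∀ m Φ Γ n → total (map (λ (α , Ψ) → α , eliminate m Φ Ψ) Γ) n ≈
                    eval Φ m * total Γ n + (- 1# * eval Φ n) * total Γ m
  total-eliminate m Φ [] n = sym (trans (+-cong (zeroʳ _) (zeroʳ _)) (+-identityˡ 0#))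
  total-eliminate m Φ ((α , Ψ) ∷ Γ) n = trans
    (+-cong (*-congˡ (eval-scale-++ _ _ Ψ Φ n)) (total-eliminate m Φ Γ n))
    (S.solve 8 (λ α ε φm φn ψm ψn γm γn →
       α :* (φm :* ψn :+ (ε :* ψm) :* φn) :+ (φm :* γn :+ (ε :* φn) :* γm) :=
       φm :* (α :* ψn :+ γn) :+ (ε :* φn) :* (α :* ψm :+ γm))
     refl α (- 1#) (eval Φ m) (eval Φ n) (eval Ψ m) (eval Ψ n) (total Γ m) (total Γ n))

  bound : List (Carrier × Functional Y) → ℕ
  bound []            = 0
  bound ((_ , Φ) ∷ Γ) = length Φ ℕ.+ bound Γ

  bounded : ∀ (Γ : List (Carrier × Functional Y)) → All (λ (_ , Φ) → length Φ ℕ.≤ bound Γ) Γ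
  bounded []            = []
  bounded ((_ , Φ) ∷ Γ) = ℕ.m≤m+n _ _ ∷
    All.map (λ le → ℕ.≤-trans le (ℕ.m≤n+m _ (length Φ))) (bounded Γ)

  module _ (s₀ : Y) where

    -- Besides having known coefficients, all branches in the functional have left `s₀` by level
    -- `n`, so they cannot cancel a term at the node of `s₀`.
    Admissible : ℕ → Functional Y → Set _
    Admissible n = All (λ (c , s) → c ∈ coefficients n × prefix n s ≢ prefix n s₀)

    Admissible-mono : ∀ {m n Φ} → m ℕ.≤ n → Admissible m Φ → Admissible n Φ
    Admissible-mono m≤n = All.map (λ (c∈ , ne) → coefficients-mono m≤n c∈ , prefix-≢-mono m≤n ne)

    Admissible-eliminate : ∀ {n Φ b Ψ} → eval Φ n ∈ values n (coefficients n) →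
      b ∈ values n (coefficients n) → Admissible n Φ → Admissible n Ψ →
      Admissible (suc n) (scale (eval Φ n) Ψ ++ scale (- 1# * b) Φ)
    Admissible-eliminate {n} a∈ b∈ admΦ admΨ = ++⁺
      (map⁺ (All.map (λ (c∈ , ne) → value*coefficient a∈ c∈ , prefix-≢-mono (ℕ.n≤1+n n) ne) admΨ))
      (map⁺ (All.map (λ (c∈ , ne) → -value*coefficient b∈ c∈ , prefix-≢-mono (ℕ.n≤1+n n) ne) admΦ))

    known : ∀ {n Φ} → Admissible n Φ → Known n Φ
    known = All.map proj₁

    -- No branch of `Ψ` shares the node of `s₀` at level `n`, so the functional takes the value `c`
    -- at the indicator of that node. Being nonzero and on the list, it does not vanish at
    -- `generic n`.
    dominant-nonZero : ∀ {n c Ψ} → ¬ (c ≈ 0#) → c ∈ coefficients n → Admissible n Ψ →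
                       suc (length Ψ) ℕ.≤ n → ¬ (eval ((c , s₀) ∷ Ψ) n ≈ 0#)
    dominant-nonZero {n} {c} {Ψ} c≉0 c∈ adm len = eval-nonZero (c∈ ∷ known adm) len
      (indicator , λ e → c≉0 (begin
        c                                                ≈⟨ trans (+-identityʳ _) (*-identityʳ c) ⟨
        c * 1# + 0#                                      ≈⟨ +-cong (*-congˡ (at-s₀ em)) others ⟨
        comb indicator (atLevel n ((c , s₀) ∷ Ψ))        ≈⟨ e ⟩
        0#                                               ∎))
      where
      choose : ∀ {σ} → Dec (σ ≡ prefix n s₀) → Carrier
      choose (yes _) = 1#
      choose (no _)  = 0#

      indicator : Vec Bool n → Carrier
      indicator σ = choose (em {P = σ ≡ prefix n s₀})

      at-s₀ : (d : Dec (prefix n s₀ ≡ prefix n s₀)) → choose d ≈ 1#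
      at-s₀ (yes _) = refl
      at-s₀ (no ne) = ⊥-elim (ne ≡.refl)

      off-s₀ : ∀ {σ} → σ ≢ prefix n s₀ → (d : Dec (σ ≡ prefix n s₀)) → choose d ≈ 0#
      off-s₀ ne (yes e) = ⊥-elim (ne e)
      off-s₀ ne (no _)  = refl

      others : comb indicator (atLevel n Ψ) ≈ 0#
      others = comb-zero (atLevel n Ψ) (map⁺ (All.map (λ (_ , ne) → off-s₀ ne em) adm))

    -- Eliminating Φ at a common zero n shortens the list Γ and keeps all zeros.
    finite-common-zeros : ∀ g {z} (Zs : Pred ℕ z) Γ → length Γ ≡ g → ∀ N c Ψ → ¬ (c ≈ 0#) →
      c ∈ coefficients N → Admissible N Ψ → All (λ (_ , Φ) → Admissible N Φ) Γ →
      (∀ {n} → Zs n → eval ((c , s₀) ∷ Ψ) n + total Γ n ≈ 0#) → FinitelyMany Zs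
    finite-common-zeros _ Zs [] _ N c Ψ c≉0 c∈ adm [] zeros = finitelyMany-⊆
      (λ n n∈ → ℕ.≰⇒> λ le → dominant-nonZero c≉0
        (coefficients-mono (ℕ.m+n≤o⇒m≤o N le) c∈)
        (Admissible-mono (ℕ.m+n≤o⇒m≤o N le) adm) (ℕ.m+n≤o⇒n≤o N le)
        (trans (sym (+-identityʳ _)) (zeros n∈)))
      (finitelyMany-< (N ℕ.+ suc (length Ψ)))
    finite-common-zeros (suc g) Zs ((α , Φ) ∷ Γ) len N c Ψ c≉0 c∈ adm (admΦ ∷ admΓ) zeros with
      em {P = ∃[ n ] Zs n × N ℕ.+ (suc (length Ψ) ℕ.+ bound ((α , Φ) ∷ Γ)) ℕ.≤ n ×
                     ¬ (eval Φ n ≈ 0#)}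
    -- `Φ` vanishes at all large members of `Zs`, so its term, with the unknown `α`, drops out
    -- there.
    ... | no ∄n = finitelyMany-⊆ cases (finitelyMany-∪
            (finitelyMany-< (N ℕ.+ (suc (length Ψ) ℕ.+ bound ((α , Φ) ∷ Γ))))
            (finite-common-zeros g (λ n → Zs n × eval Φ n ≈ 0#) Γ (ℕ.suc-injective len)
              N c Ψ c≉0 c∈ adm admΓ λ (n∈ , Φ≈0) → trans
                (+-congˡ (sym (trans (+-congʳ (trans (*-congˡ Φ≈0) (zeroʳ α))) (+-identityˡ _))))
                (zeros n∈)))
      where
      cases : ∀ n → Zs n → n ℕ.< _ ⊎ (Zs n × eval Φ n ≈ 0#)
      cases n n∈ with ℕ.<-≤-connex n (N ℕ.+ (suc (length Ψ) ℕ.+ bound ((α , Φ) ∷ Γ)))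
      ... | inj₁ n<  = inj₁ n<
      ... | inj₂ n≥  = inj₂ (n∈ , stable λ Φ≉0 → ∄n (n , n∈ , n≥ , Φ≉0))
    -- The relation at `n` times Φ(m), minus the relation at `m` times Φ(n), loses the term in `α`.
    -- The leading coefficient becomes `a * c`, nonzero by the choice of `m`, and the value `b` of
    -- the leading functional at `m` becomes a coefficient of `Φ`.
    ... | yes (m , m∈ , m≥ , Φm≉0) =
            finite-common-zeros g Zs (map (λ (α , Ψ) → α , eliminate m Φ Ψ) Γ)
              (≡.trans (length-map _ Γ) (ℕ.suc-injective len)) (suc m)
              (a * c) (scale a Ψ ++ scale (- 1# * b) Φ) (*-nonZero Φm≉0 c≉0)
              (value*coefficient a∈ (coefficients-mono N≤m c∈))
              (Admissible-eliminate a∈ b∈ (Admissible-mono N≤m admΦ) (Admissible-mono N≤m adm))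
              (map⁺ (All.zipWith
                (λ (admΨ , le) → Admissible-eliminate a∈
                  (eval∈values (known (Admissible-mono N≤m admΨ))
                    (ℕ.≤-trans le (ℕ.≤-trans (ℕ.m≤n+m _ (length Φ)) bound≤m)))
                  (Admissible-mono N≤m admΦ) (Admissible-mono N≤m admΨ))
                (admΓ , bounded Γ)))
              zeros′
      where
      N≤m : N ℕ.≤ m
      N≤m = ℕ.m+n≤o⇒m≤o N m≥

      lengths≤m : suc (length Ψ) ℕ.+ bound ((α , Φ) ∷ Γ) ℕ.≤ m
      lengths≤m = ℕ.m+n≤o⇒n≤o N m≥

      bound≤m : bound ((α , Φ) ∷ Γ) ℕ.≤ m
      bound≤m = ℕ.m+n≤o⇒n≤o (suc (length Ψ)) lengths≤m

      a b : Carrier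
      a = eval Φ m
      b = eval ((c , s₀) ∷ Ψ) m

      a∈ : a ∈ values m (coefficients m)
      a∈ = eval∈values (known (Admissible-mono N≤m admΦ)) (ℕ.m+n≤o⇒m≤o (length Φ) bound≤m)

      b∈ : b ∈ values m (coefficients m)
      b∈ = eval∈values (coefficients-mono N≤m c∈ ∷ known (Admissible-mono N≤m adm))
        (ℕ.m+n≤o⇒m≤o (suc (length Ψ)) lengths≤m)

      zeros′ : ∀ {n} → Zs n → eval ((a * c , s₀) ∷ scale a Ψ ++ scale (- 1# * b) Φ) n +
               total (map (λ (α , Ψ) → α , eliminate m Φ Ψ) Γ) n ≈ 0#
      zeros′ {n} n∈ = begin
        (a * c) * x + eval (scale a Ψ ++ scale (ε * b) Φ) n +
          total (map (λ (α , Ψ) → α , eliminate m Φ Ψ) Γ) n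
          ≈⟨ +-cong (+-congˡ (eval-scale-++ a _ Ψ Φ n)) (total-eliminate m Φ Γ n) ⟩
        (a * c) * x + (a * eval Ψ n + (ε * b) * φ) + (a * total Γ n + (ε * φ) * total Γ m)
          ≈⟨ +-identityʳ _ ⟨
        (a * c) * x + (a * eval Ψ n + (ε * b) * φ) + (a * total Γ n + (ε * φ) * total Γ m) + 0#
          -- The terms a α φ and -a α φ, which cancelled in the elimination, are put back to make
          -- the relations at `n` and `m` visible.
          ≈⟨ +-congˡ (trans (*-congˡ (-‿inverseʳ 1#)) (zeroʳ _)) ⟨
        (a * c) * x + (a * eval Ψ n + (ε * b) * φ) + (a * total Γ n + (ε * φ) * total Γ m) +
          (a * α * φ) * (1# + ε)
          ≈⟨ +-congˡ (trans (distribˡ _ _ _) (+-congʳ (*-identityʳ _))) ⟩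
        (a * c) * x + (a * eval Ψ n + (ε * b) * φ) + (a * total Γ n + (ε * φ) * total Γ m) +
          (a * α * φ + a * α * φ * ε)
          ≈⟨ S.solve 10 (λ a c x ψ e b φ γ δ α →
               ((a :* c) :* x :+ (a :* ψ :+ (e :* b) :* φ)) :+ (a :* γ :+ (e :* φ) :* δ) :+
               (a :* α :* φ :+ a :* α :* φ :* e) :=
               a :* ((c :* x :+ ψ) :+ (α :* φ :+ γ)) :+ (e :* φ) :* (b :+ (α :* a :+ δ)))
             refl a c x (eval Ψ n) ε b φ (total Γ n) (total Γ m) α ⟩
        a * ((c * x + eval Ψ n) + (α * φ + total Γ n)) + (ε * φ) * (b + (α * a + total Γ m))
          ≈⟨ +-cong (trans (*-congˡ (zeros n∈)) (zeroʳ a)) (trans (*-congˡ (zeros m∈)) (zeroʳ _)) ⟩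
        0# + 0#
          ≈⟨ +-identityˡ 0# ⟩
        0# ∎
        where
        ε x φ : Carrier
        ε = - 1#
        x = branch s₀ n
        φ = eval Φ n

    separate : ∀ {s} → s ≢ s₀ → ∃[ n ] prefix n s ≢ prefix n s₀
    separate s≢s₀ with ¬∀⇒∃¬ (λ same → s≢s₀ (ext same))
    ... | n , ne = suc n , λ e → ne (Vec.∷-injectiveˡ e)

    separateAll : ∀ l → Off s₀ l → ∃[ n ] All (λ (_ , s) → prefix n s ≢ prefix n s₀) l
    separateAll [] [] = 0 , []
    separateAll (_ ∷ l) (s≢s₀ ∷ off) with separate s≢s₀ | separateAll l off
    ... | m , ne | n , all = m ℕ.+ n , prefix-≢-mono (ℕ.m≤m+n m n) ne ∷
            All.map (prefix-≢-mono (ℕ.m≤n+m n m)) all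

  branch-hasFiniteZeros : HasFiniteZeros branch
  branch-hasFiniteZeros s₀ l off with separateAll s₀ l off
  -- Each branch of `l` starts as a functional of its own with coefficient 1, its scalar kept
  -- outside, at a level where all of them have left `s₀`.
  ... | N , ne = finite-common-zeros s₀ (length Γ) _ Γ ≡.refl N 1# [] 1≉0
      (coefficients-mono {n = N} ℕ.z≤n (here ≡.refl)) []
      (map⁺ (All.map (λ ne → (coefficients-mono {n = N} ℕ.z≤n (here ≡.refl) , ne) ∷ []) ne))
      (λ {n} e → trans (+-cong (trans (+-identityʳ _) (*-identityˡ _)) (total-singletons l n)) e)
    where
    Γ : List (Carrier × Functional Y)
    Γ = map (λ (c , s) → c , (1# , s) ∷ []) l

    total-singletons : ∀ l n → total (map (λ (c , s) → c , (1# , s) ∷ []) l) n ≈ eval l n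
    total-singletons []            n = refl
    total-singletons ((c , s) ∷ l) n = +-cong
      (*-congˡ (trans (+-identityʳ _) (*-identityˡ _))) (total-singletons l n)

-- Ultrafilters and measurable cardinals

module Measurability (em : ∀ {a} → ExcludedMiddle a) (ext : ∀ {a b} → Extensionality a b) where
  open Classical em
  open Cardinals em ext

  prime⇒ultra : ∀ {ℓ} {I : Set ℓ} (𝓕 : Filter I) → Proper 𝓕 →
                (∀ K → K ∈ᵘ sets 𝓕 ⊎ ∁ K ∈ᵘ sets 𝓕) → IsUltrafilter 𝓕
  prime⇒ultra 𝓕 proper prime = proper , maximal
    where
    maximal : ∀ 𝓖 → Proper 𝓖 → sets 𝓕 ⊆ sets 𝓖 → sets 𝓖 ⊆ sets 𝓕
    maximal 𝓖 𝓖-proper 𝓕⊆𝓖 {K} K∈𝓖 with prime K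
    ... | inj₁ K∈𝓕  = K∈𝓕
    ... | inj₂ ∁K∈𝓕 = ⊥-elim (𝓖-proper (Filter.⊆-closed 𝓖 (Filter.∩-closed 𝓖 K∈𝓖 (𝓕⊆𝓖 ∁K∈𝓕))
                        (λ (i∈K , i∉K) → ⊥-elim (i∉K i∈K))))

  -- A nonprincipal ultrafilter has maps onto sets of cardinality ≤ |I| with fibres outside
  -- the ultrafilter; the least cardinality of the image is measurable.
  module _ {ℓ} {I : Set ℓ} (𝒰 : Filter I) (proper : Proper 𝒰)
           (prime : ∀ J → J ∈ᵘ sets 𝒰 ⊎ ∁ J ∈ᵘ sets 𝒰)
           {a r} {κ : Setoid a r} (complete : Complete⁺ κ 𝒰)
           {K : Set ℓ} (K≼κ : ≡.setoid K ≼ κ) (κ≼K : κ ≼ ≡.setoid K)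
           (below : BelowMeasurablesAbove κ I) where
    open Filter 𝒰 using (U-closed; ⊆-closed; ∩-closed)

    Large : Pred I ℓ → Set ℓ
    Large J = J ∈ᵘ sets 𝒰

    ¬Large⇒∁ : ∀ {J} → ¬ Large J → Large (∁ J)
    ¬Large⇒∁ {J} ¬large = [ (λ large → ⊥-elim (¬large large)) , id ]′ (prime J)

    inhabited : ∀ {J} → Large J → ∃ J
    inhabited {J} large = stable λ ∄i → proper (⊆-closed large (λ {i} i∈J → ⊥-elim (∄i (i , i∈J))))

    Large-⋂Fin : ∀ n (J : Fin n → Pred I ℓ) → (∀ m → Large (J m)) → Large (λ i → ∀ m → J m i)
    Large-⋂Fin zero    J large = ⊆-closed U-closed (λ _ ())
    Large-⋂Fin (suc n) J large = ⊆-closed (∩-closed (large zero) (Large-⋂Fin n (J ∘ suc) (large ∘ suc)))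
      λ { (p , ps) zero → p ; (p , ps) (suc m) → ps m }

    -- Sets of size at most |I| are represented by subsets of `I`, which keeps them in the universe
    -- of the measurable cardinals considered.
    SmallFibredMapTo : Subset I → Set ℓ
    SmallFibredMapTo P = Σ[ h ∈ (I → I) ] (∀ i → T (P (h i))) × (∀ j → ¬ Large (λ i → h i ≡ j))

    module Minimal (P : Subset I) (h : I → I) (h∈P : ∀ i → T (P (h i)))
                   (small : ∀ j → ¬ Large (λ i → h i ≡ j))
                   (minimal : ∀ Q → SmallFibredMapTo Q →
                     Σ[ φ ∈ (Elements P → Elements Q) ] (∀ {w w′} → φ w ≡ φ w′ → w ≡ w′)) where

      μ : Set ℓ
      μ = Elements P

      η : I → μ
      η i = h i , h∈P i

      small-fibre : ∀ w → ¬ Large (λ i → η i ≡ w)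
      small-fibre w large = small (proj₁ w) (⊆-closed large (cong proj₁))

      large-∁fibre : ∀ w → Large (λ i → η i ≢ w)
      large-∁fibre w = ¬Large⇒∁ (small-fibre w)

      𝒱 : Filter μ
      𝒱 = record
        { sets     = λ W → Large (W ∘ η)
        ; U-closed = U-closed
        ; ⊆-closed = λ large W⊆W′ → ⊆-closed large W⊆W′
        ; ∩-closed = ∩-closed
        }

      μ-infinite : Infinite (≡.setoid μ)
      μ-infinite (n , μ↔Fin) = let (i , i∉) = inhabited (Large-⋂Fin n _ (large-∁fibre ∘ from)) in
        i∉ (to (η i)) (≡.sym (strictlyInverseʳ (η i)))
        where open Inverse μ↔Fin using (to; from; strictlyInverseʳ)

      𝒱-nonprincipal : ¬ IsPrincipal 𝒱
      𝒱-nonprincipal (w , principal) = small-fibre w (Equivalence.from (principal (λ w′ → w′ ≡ w)) ≡.refl)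

      -- Suppose fewer than |μ| large sets had an intersection that is not large. Sending almost
      -- every `i` to an `x` with `η i` outside `J x` gives a map to `X` with small fibres. As `X`
      -- embeds in `I`, minimality of `P` embeds `μ` in `X`, a contradiction.
      𝒱-complete : Complete (≡.setoid μ) 𝒱
      𝒱-complete {X} (X≼μ , μ⋠X) J large = stable λ ¬large →
        contradiction (¬Large⇒∁ ¬large) (proj₁ (¬∀⇒∃¬ (proj₂ (inhabited (¬Large⇒∁ ¬large)))))
        where
        open Injection X≼μ using (to; injective)

        module _ (E : Large (λ i → ¬ (∀ x → J x (η i)))) (x₀ : X) where

          choose : ∀ {i} → Dec (∃[ x ] ¬ J x (η i)) → X
          choose (yes (x , _)) = x
          choose (no _)        = x₀

          q : I → X
          q i = choose (em {P = ∃[ x ] ¬ J x (η i)})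

          q-misses : ∀ i → ¬ (∀ x → J x (η i)) → ¬ J (q i) (η i)
          q-misses i ¬all = go em
            where
            go : (d : Dec (∃[ x ] ¬ J x (η i))) → ¬ J (choose d) (η i)
            go (yes (_ , ¬Jx)) = ¬Jx
            go (no ∄x)         = ⊥-elim (∄x (¬∀⇒∃¬ ¬all))

          q-small-fibre : ∀ x → ¬ Large (λ i → q i ≡ x)
          q-small-fibre x large-x with inhabited (∩-closed large-x (∩-closed E (large x)))
          ... | i , ≡.refl , ¬all , Jx = q-misses i ¬all Jx

          image : Subset I
          image j = ⌊ (∃[ x ] proj₁ (to x) ≡ j) ⌋

          map-to-image : SmallFibredMapTo image
          map-to-image = (λ i → proj₁ (to (q i))) , (λ i → to⌊⌋ (q i , ≡.refl)) , λ j large-j →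
            let (i , e) = inhabited large-j in
            q-small-fibre (q i) (⊆-closed large-j λ {i′} e′ →
              injective (Elements-≡ (≡.trans e′ (≡.sym e))))

          contradiction : ⊥
          contradiction = let (φ , φ-injective) = minimal image map-to-image in
            μ⋠X (mk↣ {to = λ w → preimage (φ w)} λ {w} {w′} e →
              φ-injective (Elements-≡ (≡.trans (≡.sym (preimage-≡ (φ w)))
                (≡.trans (cong (proj₁ ∘ to) e) (preimage-≡ (φ w′))))))
            where
            preimage : Elements image → X
            preimage (_ , j∈) = proj₁ (from⌊⌋ j∈)

            preimage-≡ : ∀ e → proj₁ (to (preimage e)) ≡ proj₁ e
            preimage-≡ (_ , j∈) = proj₂ (from⌊⌋ j∈)

      μ-measurable : Measurable μ
      μ-measurable = μ-infinite , 𝒱 , prime⇒ultra 𝒱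
        (λ ∅∈ → proper (⊆-closed ∅∈ λ ())) (λ W → prime (W ∘ η)) , 𝒱-nonprincipal , 𝒱-complete

      -- The complements of the fibres of `η` are large and have empty intersection, so completeness
      -- rules out that they can be indexed within κ.
      μ⋠κ : ¬ (≡.setoid μ ≼ κ)
      μ⋠κ μ≼κ = let (i , i∉) = inhabited (complete μ≼κ (λ w i → η i ≢ w) large-∁fibre) in
        i∉ (η i) ≡.refl

      κ≼μ : κ ≼ ≡.setoid μ
      -- Comparability of two cardinals is `smallest` for a family of two sets; `K` is the copy of κ
      -- in the universe of `μ`.
      κ≼μ with smallest (λ { true → K ; false → μ }) true
      ... | true  , smaller = Composition.injection κ≼K (mk↣ (proj₂ (smaller false)))
      ... | false , smaller = ⊥-elim (μ⋠κ (Composition.injection (mk↣ (proj₂ (smaller true))) K≼κ))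

      absurd : ⊥
      absurd = proj₂ (below μ μ-measurable (κ≼μ , μ⋠κ)) (mk↣ (Elements-≡ {S = P}))

    singleton-large : ∃[ i₀ ] Large (λ i → i ≡ i₀)
    singleton-large = stable λ ∄i₀ →
      -- If no singleton is large, the identity of `I` has small fibres, so the family to be
      -- minimised is inhabited.
      let ((P , h , h∈P , small) , minimal) = smallest {I = ∃ SmallFibredMapTo} (Elements ∘ proj₁)
            ((λ _ → true) , id , (λ _ → tt) , λ i₀ large → ∄i₀ (i₀ , large))
      in Minimal.absurd P h h∈P small (λ Q maps → minimal (Q , maps))

lookup-injective : ∀ {a r} (S : Setoid a r) {xs} → Unique S xs → ∀ {i j} →
                   Setoid._≈_ S (lookup xs i) (lookup xs j) → i ≡ j
lookup-injective S (_ ∷ _)   {zero}  {zero}  _ = ≡.refl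
lookup-injective S (x≉ ∷ _)  {zero}  {suc j} e = ⊥-elim (All.lookup x≉ (∈-lookup j) e)
lookup-injective S (x≉ ∷ _)  {suc i} {zero}  e = ⊥-elim (All.lookup x≉ (∈-lookup i) (Setoid.sym S e))
lookup-injective S (_ ∷ uniq) {suc i} {suc j} e = cong suc (lookup-injective S uniq e)


-- Negligible elements and null sets

module Products (em : ∀ {a} → ExcludedMiddle a) (ext : ∀ {a b} → Extensionality a b)
                {ℓ} {k : CommutativeRing ℓ ℓ} (isField : IsField k)
                {I : Set ℓ} (A : I → Algebra k ℓ ℓ) (B : Algebra k ℓ ℓ)
                (f : Hom (Π A) B) (f-surjective : IsSurjective f) where
  private
    module k = CommutativeRing k
    module A i = Algebra (A i)
    module ΠA = Algebra (Π A)
    module B = Algebra B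
    module B-Properties = AlgebraProperties B
    module Ann = Ideal (annihilator B)
  open Classical em
  open FiniteZeros em ext isField
  open Hom f using (⟦⟧-cong; +ᴹ-homo; *ₗ-homo; ·-homo; 0ᴹ-homo)

  infixr 7 _•_
  _•_ : (I → k.Carrier) → ΠA.Carrierᴹ → ΠA.Carrierᴹ
  (u • a) i = A._*ₗ_ i (u i) (a i)

  Negligible : ΠA.Carrierᴹ → Set ℓ
  Negligible a = Ann.carrier (⟦ f ⟧ a)

  negligible-resp : ∀ {a a′} → a ΠA.≈ᴹ a′ → Negligible a → Negligible a′
  negligible-resp e = Ann.resp (⟦⟧-cong e)

  negligible-+ : ∀ {a a′} → Negligible a → Negligible a′ → Negligible (a ΠA.+ᴹ a′)
  negligible-+ p q = Ann.resp (B.≈ᴹ-sym (+ᴹ-homo _ _)) (Ann.+-closed p q)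

  negligible-≈0 : ∀ {a} → ⟦ f ⟧ a B.≈ᴹ B.0ᴹ → Negligible a
  negligible-≈0 e = Ann.resp (B.≈ᴹ-sym e) Ann.0-closed

  -- f (u a) f (b) = f (a) f (u b), and every element of B has the form f (b).
  negligible-• : ∀ u {a} → Negligible a → Negligible (u • a)
  negligible-• u {a} neg y with f-surjective y
  ... | b , fb≈y = (begin
      ⟦ f ⟧ (u • a) B.· y              ≈⟨ B.·-cong B.≈ᴹ-refl (fb≈y ΠA.≈ᴹ-refl) ⟨
      ⟦ f ⟧ (u • a) B.· ⟦ f ⟧ b        ≈⟨ ·-homo _ _ ⟨
      ⟦ f ⟧ ((u • a) ΠA.· b)           ≈⟨ ⟦⟧-cong (slide a b) ⟩
      ⟦ f ⟧ (a ΠA.· (u • b))           ≈⟨ ·-homo _ _ ⟩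
      ⟦ f ⟧ a B.· ⟦ f ⟧ (u • b)        ≈⟨ proj₁ (neg _) ⟩
      B.0ᴹ                             ∎) , (begin
      y B.· ⟦ f ⟧ (u • a)              ≈⟨ B.·-cong (fb≈y ΠA.≈ᴹ-refl) B.≈ᴹ-refl ⟨
      ⟦ f ⟧ b B.· ⟦ f ⟧ (u • a)        ≈⟨ ·-homo _ _ ⟨
      ⟦ f ⟧ (b ΠA.· (u • a))           ≈⟨ ⟦⟧-cong (ΠA.≈ᴹ-sym (slide b a)) ⟩
      ⟦ f ⟧ ((u • b) ΠA.· a)           ≈⟨ ·-homo _ _ ⟩
      ⟦ f ⟧ (u • b) B.· ⟦ f ⟧ a        ≈⟨ proj₂ (neg _) ⟩
      B.0ᴹ                             ∎)
    where
    open SetoidReasoning B.≈ᴹ-setoid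

    slide : ∀ a b → (u • a) ΠA.· b ΠA.≈ᴹ a ΠA.· (u • b)
    slide a b i = A.≈ᴹ-trans i (A.*ₗ-· i (u i) _ _) (A.≈ᴹ-sym i (A.·-*ₗ i (u i) _ _))

  •-assoc : ∀ u v a → u • v • a ΠA.≈ᴹ (λ i → u i k.* v i) • a
  •-assoc u v a i = A.≈ᴹ-sym i (A.*ₗ-assoc i (u i) (v i) (a i))

  •-comm : ∀ u v a → u • v • a ΠA.≈ᴹ v • u • a
  •-comm u v a i = A.≈ᴹ-trans i (•-assoc u v a i)
    (A.≈ᴹ-trans i (A.*ₗ-cong i (k.*-comm (u i) (v i)) (A.≈ᴹ-refl i)) (A.≈ᴹ-sym i (•-assoc v u a i)))

  Zero : ∀ i → A.Carrierᴹ i → Set ℓ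
  Zero i x = A._≈ᴹ_ i x (A.0ᴹ i)

  *ₗ-Zero : ∀ {i} c {x} → Zero i x → Zero i (A._*ₗ_ i c x)
  *ₗ-Zero {i} c z = A.≈ᴹ-trans i (A.*ₗ-cong i k.refl z) (A.*ₗ-zeroʳ i c)

  negligible-divide : ∀ u {a} → (∀ i → Zero i (a i) ⊎ ¬ (u i k.≈ k.0#)) →
                      Negligible (u • a) → Negligible a
  negligible-divide u {a} nonzero neg = negligible-resp (λ i → divided i (nonzero i))
    (negligible-• (λ i → u i ⁻¹) neg)
    where
    divided : ∀ i → Zero i (a i) ⊎ ¬ (u i k.≈ k.0#) →
              A._≈ᴹ_ i (((λ i → u i ⁻¹) • u • a) i) (a i)
    divided i (inj₁ a≈0) = A.≈ᴹ-trans i (*ₗ-Zero _ (*ₗ-Zero _ a≈0)) (A.≈ᴹ-sym i a≈0)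
    divided i (inj₂ u≉0) = A.≈ᴹ-trans i (•-assoc (λ i → u i ⁻¹) u a i)
      (A.≈ᴹ-trans i (A.*ₗ-cong i (⁻¹-inverseˡ u≉0) (A.≈ᴹ-refl i)) (A.*ₗ-identityˡ i (a i)))

  indicate : ∀ {p} {P : Set p} → Dec P → k.Carrier
  indicate (yes _) = k.1#
  indicate (no _)  = k.0#

  restrict : ∀ {p} → Pred I p → ΠA.Carrierᴹ → ΠA.Carrierᴹ
  restrict J a = (λ i → indicate (em {P = J i})) • a

  restrict-in : ∀ {p} (J : Pred I p) a {i} → J i → A._≈ᴹ_ i (restrict J a i) (a i)
  restrict-in J a {i} i∈J = go em
    where
    go : (d : Dec (J i)) → A._≈ᴹ_ i (A._*ₗ_ i (indicate d) (a i)) (a i)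
    go (yes _)  = A.*ₗ-identityˡ i (a i)
    go (no i∉J) = ⊥-elim (i∉J i∈J)

  restrict-out : ∀ {p} (J : Pred I p) a {i} → ¬ J i → Zero i (restrict J a i)
  restrict-out J a {i} i∉J = go em
    where
    go : (d : Dec (J i)) → Zero i (A._*ₗ_ i (indicate d) (a i))
    go (yes i∈J) = ⊥-elim (i∉J i∈J)
    go (no _)    = A.*ₗ-zeroˡ i (a i)

  restrict-split : ∀ {p} (J : Pred I p) a → restrict J a ΠA.+ᴹ restrict (∁ J) a ΠA.≈ᴹ a
  restrict-split J a i with em {P = J i}
  ... | yes i∈J = A.≈ᴹ-trans i
    (A.+ᴹ-cong i (A.*ₗ-identityˡ i _) (restrict-out (∁ J) a (λ i∉J → i∉J i∈J)))
    (A.+ᴹ-identityʳ i _)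
  ... | no i∉J  = A.≈ᴹ-trans i
    (A.+ᴹ-cong i (A.*ₗ-zeroˡ i _) (restrict-in (∁ J) a i∉J))
    (A.+ᴹ-identityˡ i _)

  Supported : ∀ {p} → Pred I p → Pred ΠA.Carrierᴹ (ℓ ⊔ p)
  Supported J a = ∀ i → ¬ J i → Zero i (a i)

  restrict-Supported : ∀ {p} (J : Pred I p) a → Supported J (restrict J a)
  restrict-Supported J a i = restrict-out J a

  Null : ∀ {p} → Pred I p → Set (ℓ ⊔ p)
  Null J = ∀ a → Supported J a → Negligible a

  Null-⊆ : ∀ {p q} {J : Pred I p} {K : Pred I q} → J ⊆ K → Null K → Null J
  Null-⊆ J⊆K null a supp = null a (λ i i∉K → supp i (i∉K ∘ J⊆K))

  Null-empty : ∀ {p} {J : Pred I p} → (∀ i → ¬ J i) → Null J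
  Null-empty empty a supp = negligible-≈0 (B.≈ᴹ-trans (⟦⟧-cong (λ i → supp i (empty i))) 0ᴹ-homo)

  Null-∪ : ∀ {p q} {J : Pred I p} {K : Pred I q} → Null J → Null K → Null (λ i → J i ⊎ K i)
  Null-∪ {J = J} {K} nullJ nullK a supp = negligible-resp (restrict-split J a)
    (negligible-+ (nullJ _ (restrict-Supported J a)) (nullK _ supp′))
    where
    supp′ : Supported K (restrict (∁ J) a)
    supp′ i i∉K with em {P = J i}
    ... | yes i∈J = restrict-out (∁ J) a (λ i∉J → i∉J i∈J)
    ... | no i∉J  = *ₗ-Zero _ (supp i [ i∉J , i∉K ]′)

  Null-Any : ∀ {s p} {S : Set s} {J : S → Pred I p} → (∀ s → Null (J s)) → ∀ xs →
             Null (λ i → Any (λ s → J s i) xs)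
  Null-Any null []       = Null-empty λ _ ()
  Null-Any null (x ∷ xs) = Null-⊆ (λ { (here p) → inj₁ p ; (there p) → inj₂ p })
    (Null-∪ (null x) (Null-Any null xs))

  -- The partial map `h` encodes disjoint parts of `I` indexed by `S`, and `nothing` marks the
  -- indices in no part.
  pull : ∀ {s} {S : Set s} → (I → Maybe S) → (S → k.Carrier) → I → k.Carrier
  pull h u i = maybe′ u k.0# (h i)

  Kernel : ∀ {s} {S : Set s} → ΠA.Carrierᴹ → (I → Maybe S) → Set _
  Kernel {S = S} a h = Σ[ u ∈ (S → k.Carrier) ]
    ⟦ f ⟧ (pull h u • a) B.≈ᴹ B.0ᴹ × FinitelyMany (λ s → u s k.≈ k.0#)

  HasKernels : ∀ {s} → Set s → Set _
  HasKernels S = ∀ a (h : I → Maybe S) → Kernel a h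

  -- On the finitely many `J s` with `u s` zero, `a` is negligible by finite unions. Off them, `u`
  -- can be divided out of the killed element `pull h u • a`.
  Null-⋃ : ∀ {s p} {S : Set s} → HasKernels S → (J : S → Pred I p) → (∀ s → Null (J s)) →
           Null (λ i → ∃[ s ] J s i)
  Null-⋃ {S = S} kernels J null a supp = conclude (kernels a h)
    where
    choose : ∀ {i} → Dec (∃[ s ] J s i) → Maybe S
    choose (yes (s , _)) = just s
    choose (no _)        = nothing

    -- One chosen `s` per index makes the possibly overlapping sets disjoint.
    h : I → Maybe S
    h i = choose (em {P = ∃[ s ] J s i})

    conclude : Kernel a h → Negligible a
    conclude (u , killed , zeros , cover) = negligible-resp (restrict-split W a) (negligible-+
      (Null-Any null zeros _ (restrict-Supported W a))
      (negligible-divide (pull h u) (λ i → nonzero i em)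
        (negligible-resp (•-comm _ (pull h u) a)
          (negligible-• (λ i → indicate (em {P = ∁ W i})) (negligible-≈0 killed)))))
      where
      W : Pred I _
      W i = Any (λ s → J s i) zeros

      nonzero : ∀ i (d : Dec (∃[ s ] J s i)) →
        Zero i (restrict (∁ W) a i) ⊎ ¬ (maybe′ u k.0# (choose d) k.≈ k.0#)
      nonzero i (no ∄s) = inj₁ (*ₗ-Zero _ (supp i ∄s))
      nonzero i (yes (s , i∈Js)) with em {P = W i}
      ... | yes i∈W = inj₁ (restrict-out (∁ W) a (λ i∉W → i∉W i∈W))
      ... | no i∉W  = inj₂ λ u≈0 → i∉W (Any.map (λ { ≡.refl → i∈Js }) (cover s u≈0))

  positive : ∀ {p} {J : Pred I p} → ¬ Null J → ∃[ a ] Supported J a × ¬ Negligible a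
  positive ¬null with ¬∀⇒∃¬ ¬null
  ... | a , ¬imp = a , stable (λ ¬supp → ¬imp (λ supp → ⊥-elim (¬supp supp))) , λ neg → ¬imp (λ _ → neg)

  -- Non-negligible elements, one from each `D n`, are glued into a single `a`. The killed multiple
  -- of `a`, restricted to a part where `u` is nonzero and divided by `u`, shows the element of that
  -- part to be negligible.
  ¬infinitely-many-positive : ∀ {p} → HasKernels ℕ → (D : ℕ → Pred I p) →
    (∀ {m n i} → D m i → D n i → m ≡ n) → ¬ (∀ n → ¬ Null (D n))
  ¬infinitely-many-positive kernels D disjoint pos = conclude (kernels a h)
    where
    part : ℕ → ΠA.Carrierᴹ
    part n = proj₁ (positive (pos n))

    chooseIndex : ∀ {i} → Dec (∃[ n ] D n i) → Maybe ℕ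
    chooseIndex (yes (n , _)) = just n
    chooseIndex (no _)        = nothing

    h : I → Maybe ℕ
    h i = chooseIndex (em {P = ∃[ n ] D n i})

    h-just : ∀ {n i} → D n i → h i ≡ just n
    h-just {n} {i} i∈Dn = go em
      where
      go : (d : Dec (∃[ n ] D n i)) → chooseIndex d ≡ just n
      go (yes (m , i∈Dm)) = cong just (disjoint i∈Dm i∈Dn)
      go (no ∄n)          = ⊥-elim (∄n (n , i∈Dn))

    a : ΠA.Carrierᴹ
    a i = maybe′ (λ n → part n i) (A.0ᴹ i) (h i)

    conclude : ¬ Kernel a h
    conclude (u , killed , zeros , cover) with fresh zeros
    ... | n , n∉zeros = proj₂ (proj₂ (positive (pos n)))
        (negligible-resp recover
          (negligible-divide (pull h u) nonzero
            (negligible-resp (•-comm _ (pull h u) a)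
              (negligible-• (λ i → indicate (em {P = D n i})) (negligible-≈0 killed)))))
      where
      recover : restrict (D n) a ΠA.≈ᴹ part n
      recover i with em {P = D n i}
      ... | no i∉D  = A.≈ᴹ-trans i (A.*ₗ-zeroˡ i _) (A.≈ᴹ-sym i (proj₁ (proj₂ (positive (pos n))) i i∉D))
      ... | yes i∈D = A.≈ᴹ-trans i (A.*ₗ-identityˡ i _)
        (A.≈ᴹ-reflexive i (cong (maybe′ (λ n → part n i) (A.0ᴹ i)) (h-just i∈D)))

      nonzero : ∀ i → Zero i (restrict (D n) a i) ⊎ ¬ (pull h u i k.≈ k.0#)
      nonzero i with em {P = D n i}
      ... | no _    = inj₁ (A.*ₗ-zeroˡ i _)
      ... | yes i∈D = inj₂ λ u≈0 → n∉zeros (cover n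
        (k.trans (k.reflexive (cong (maybe′ u k.0#) (≡.sym (h-just i∈D)))) u≈0))

  -- Decomposition into atoms, and their ultrafilters

  infixl 6 _∖_
  _∖_ : ∀ {p q} → Pred I p → Pred I q → Pred I (p ⊔ q)
  J ∖ K = J ∩ ∁ K

  IsAtom : Pred I ℓ → Set (Level.suc ℓ)
  IsAtom J = ¬ Null J × (∀ (K : Pred I ℓ) → Null (J ∩ K) ⊎ Null (J ∖ K))

  -- A cover up to a null set is asked for, so that covers of two halves of `J` can simply be
  -- concatenated.
  Atomic : Pred I ℓ → Set (Level.suc ℓ)
  Atomic J = ∃[ Ks ] All IsAtom Ks × Null (J ∖ λ i → Any (λ K → K i) Ks)

  -- `J` is neither null (empty cover) nor an atom (cover by itself), so some `K` cuts it into two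
  -- non-null halves. They cannot both be atomic: a half that is not atomic is kept, and the other
  -- one is discarded.
  split-nonAtomic : ∀ J → ¬ Atomic J → ∃[ J′ ] J′ ⊆ J × ¬ Null (J ∖ J′) × ¬ Atomic J′
  split-nonAtomic J ¬atomic with em {P = ∃[ K ] ¬ Null (J ∩ K) × ¬ Null (J ∖ K)}
  ... | no ∄K = ⊥-elim (¬atomic (J ∷ [] , (¬null , atom) ∷ [] ,
                  Null-empty λ i (i∈J , i∉J) → i∉J (here i∈J)))
    where
    ¬null : ¬ Null J
    ¬null null = ¬atomic ([] , [] , Null-⊆ proj₁ null)

    atom : ∀ K → Null (J ∩ K) ⊎ Null (J ∖ K)
    atom K with em {P = Null (J ∩ K)}
    ... | yes null = inj₁ null
    ... | no ¬null = inj₂ (stable λ ¬null′ → ∄K (K , ¬null , ¬null′))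
  ... | yes (K , ¬null , ¬null′) with em {P = Atomic (J ∩ K)}
  ...   | no ¬atomic′ = J ∩ K , proj₁ ,
            (λ null → ¬null′ (Null-⊆ (λ (i∈J , i∉K) → i∈J , i∉K ∘ proj₂) null)) , ¬atomic′
  ...   | yes (Ks , atoms , null) = J ∖ K , proj₁ ,
            (λ null → ¬null (Null-⊆ (λ (i∈J , i∈K) → i∈J , λ (_ , i∉K) → i∉K i∈K) null)) ,
            λ (Ks′ , atoms′ , null′) → ¬atomic (Ks ++ Ks′ , ++⁺ atoms atoms′ ,
              Null-⊆ (λ {i} (i∈J , i∉) → cases i i∈J i∉) (Null-∪ null null′))
    where
    cases : ∀ i {Ks Ks′} → J i → ¬ Any (λ K → K i) (Ks ++ Ks′) →
            (J ∩ K ∖ λ i → Any (λ K → K i) Ks) i ⊎ (J ∖ K ∖ λ i → Any (λ K → K i) Ks′) i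
    cases i {Ks} i∈J i∉ with em {P = K i}
    ... | yes i∈K = inj₁ ((i∈J , i∈K) , i∉ ∘ Any.++⁺ˡ)
    ... | no i∉K  = inj₂ ((i∈J , i∉K) , i∉ ∘ Any.++⁺ʳ Ks)

  -- Repeated splitting gives a decreasing sequence whose successive differences are disjoint and
  -- non-null.
  atomic : HasKernels ℕ → Atomic (λ _ → ⊤)
  atomic kernels = stable λ ¬atomic → let
      chain : ℕ → ∃[ J ] ¬ Atomic J
      chain = λ n → chainFrom ¬atomic n
    in ¬infinitely-many-positive kernels (λ n → proj₁ (chain n) ∖ proj₁ (chain (suc n)))
         (disjoint ¬atomic) (λ n → proj₁ (proj₂ (proj₂ (split-nonAtomic _ (proj₂ (chain n))))))
    where
    module _ (¬atomic : ¬ Atomic (λ _ → ⊤)) where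
      chainFrom : ℕ → ∃[ J ] ¬ Atomic J
      chainFrom zero    = (λ _ → ⊤) , ¬atomic
      chainFrom (suc n) = let (J , ¬at) = chainFrom n ; (J′ , _ , _ , ¬at′) = split-nonAtomic J ¬at
                          in J′ , ¬at′

      decreasing : ∀ {m n} → m ℕ.≤ n → proj₁ (chainFrom n) ⊆ proj₁ (chainFrom m)
      decreasing {n = zero}  ℕ.z≤n i∈ = i∈
      decreasing {n = suc n} m≤1+n i∈ with ℕ.m≤n⇒m<n∨m≡n m≤1+n
      ... | inj₁ m≤n    = decreasing (ℕ.s≤s⁻¹ m≤n) (proj₁ (proj₂ (split-nonAtomic _ (proj₂ (chainFrom n)))) i∈)
      ... | inj₂ ≡.refl = i∈

      disjoint : ∀ {m n i} → (proj₁ (chainFrom m) ∖ proj₁ (chainFrom (suc m))) i →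
                 (proj₁ (chainFrom n) ∖ proj₁ (chainFrom (suc n))) i → m ≡ n
      disjoint {m} {n} (i∈m , i∉m) (i∈n , i∉n) with ℕ.<-cmp m n
      ... | tri< m<n _ _ = ⊥-elim (i∉m (decreasing m<n i∈n))
      ... | tri≈ _ m≡n _ = m≡n
      ... | tri> _ _ n<m = ⊥-elim (i∉n (decreasing n<m i∈m))

  ultrafilter : Pred I ℓ → Filter I
  ultrafilter K = record
    { sets     = λ J → Null (K ∖ J)
    ; U-closed = Null-empty λ _ (_ , ∉U) → ∉U _
    ; ⊆-closed = λ null J⊆J′ → Null-⊆ (λ (i∈K , i∉J′) → i∈K , i∉J′ ∘ J⊆J′) null
    ; ∩-closed = λ {J} {J′} null null′ → Null-⊆ (λ {i} → cases J J′ {i}) (Null-∪ null null′)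
    }
    where
    cases : ∀ J J′ → K ∖ (J ∩ J′) ⊆ λ i → (K ∖ J) i ⊎ (K ∖ J′) i
    cases J J′ {i} (i∈K , i∉) with em {P = J i}
    ... | yes i∈J = inj₂ (i∈K , λ i∈J′ → i∉ (i∈J , i∈J′))
    ... | no i∉J  = inj₁ (i∈K , i∉J)

  module _ {K : Pred I ℓ} (K-atom : IsAtom K) where

    ultrafilter-proper : Proper (ultrafilter K)
    ultrafilter-proper null = proj₁ K-atom (Null-⊆ (λ i∈K → i∈K , λ ()) null)

    ultrafilter-prime : ∀ J → J ∈ᵘ sets (ultrafilter K) ⊎ ∁ J ∈ᵘ sets (ultrafilter K)
    ultrafilter-prime J = [ (λ null → inj₂ (Null-⊆ (λ (i∈K , i∉∁J) → i∈K , stable i∉∁J) null)) , inj₁ ]′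
      (proj₂ K-atom J)

    ultrafilter-complete : ∀ {X : Set ℓ} → HasKernels X → (J : X → Pred I ℓ) →
      (∀ x → Null (K ∖ J x)) → Null (K ∖ λ i → ∀ x → J x i)
    ultrafilter-complete kernels J null = Null-⊆
      (λ (i∈K , i∉) → let (x , i∉Jx) = ¬∀⇒∃¬ i∉ in x , i∈K , i∉Jx)
      (Null-⋃ kernels (λ x → K ∖ J x) null)

  -- The factorisations and the decomposition of f

  agree⇒≋ : ∀ {p} {J : Pred I p} → Null J → ∀ {a a′} → (∀ i → ¬ J i → A._≈ᴹ_ i (a i) (a′ i)) →
            Algebra._≈ᴹ_ (B /Z) (⟦ f ⟧ a) (⟦ f ⟧ a′)
  agree⇒≋ null {a} {a′} agree = Ann.resp
    (B.≈ᴹ-trans (+ᴹ-homo a _) (B.+ᴹ-congˡ (Hom.-ᴹ-homo f a′)))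
    (null (a ΠA.-ᴹ a′) (λ i i∉J → AlgebraProperties.≈⇒-ᴹ≈0 (A i) (agree i i∉J)))

  zeroHom : ∀ {c ℓc d ℓd} {C : Algebra k c ℓc} {D : Algebra k d ℓd} → Hom C D
  zeroHom {D = D} = mkHom (λ _ → 0ᴹ) (λ _ → ≈ᴹ-refl)
    (λ _ _ → ≈ᴹ-sym (+ᴹ-identityˡ 0ᴹ)) ≈ᴹ-refl
    (λ _ → ≈ᴹ-sym (AbelianGroupProperties.ε⁻¹≈ε +ᴹ-abelianGroup))
    (λ c _ → ≈ᴹ-sym (*ₗ-zeroʳ c))
    (λ _ _ → ≈ᴹ-sym (AlgebraProperties.·-zeroˡ D 0ᴹ))
    where open Algebra D

  private
    πf : Hom (Π A) (B /Z)
    πf = π B ∘ₐ f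

  module _ (Ks : List (Pred I ℓ)) (null : Null ((λ _ → ⊤ {ℓ}) ∖ λ i → Any (λ K → K i) Ks)) where

    glueAt : ∀ i → Dec (∃[ m ] lookup Ks m i) → Hom (Π {I = Fin (length Ks)} (λ _ → Π A)) (A i)
    glueAt i (yes (m , _)) = projection A i ∘ₐ projection (λ _ → Π A) m
    glueAt i (no _)        = zeroHom

    -- Every index reads its coordinate from the tuple member of one chosen set of `Ks` containing
    -- it. A change of the members that is invisible in the ultraproducts thus alters the glued
    -- element only on a null set.
    glue : Hom (Π {I = Fin (length Ks)} (λ _ → Π A)) (Π A)
    glue = tuple (λ i → glueAt i em)

    factorsThroughUltraproducts :
      FactorsThrough πf (tuple (λ m → reducedProductMap A (ultrafilter (lookup Ks m))))
    -- The reduced products share their carrier with `Π A`, so `h` only has to be shown compatible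
    -- with the coarser equality.
    factorsThroughUltraproducts = mkHom ⟦ h ⟧
        (λ {x} {y} x≋y → agree⇒≋
          (Null-Any {J = λ m → lookup Ks m ∖ λ i → A._≈ᴹ_ i (x m i) (y m i)} x≋y (allFin _))
          (λ i i∉ → glue-cong x y i i∉ em))
        (Hom.+ᴹ-homo h) (Hom.0ᴹ-homo h) (Hom.-ᴹ-homo h) (Hom.*ₗ-homo h) (Hom.·-homo h)
      , λ x → agree⇒≋ null (λ i i∉ → glue-diagonal x i i∉ em)
      where
      h : Hom (Π {I = Fin (length Ks)} (λ _ → Π A)) (B /Z)
      h = πf ∘ₐ glue

      glue-cong : ∀ x y i →
        ¬ Any (λ m → (lookup Ks m ∖ λ i → A._≈ᴹ_ i (x m i) (y m i)) i) (allFin (length Ks)) →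
        ∀ d → A._≈ᴹ_ i (⟦ glueAt i d ⟧ x) (⟦ glueAt i d ⟧ y)
      glue-cong x y i i∉ (yes (m , i∈K)) = stable λ ne →
        i∉ (Any.map (λ { ≡.refl → i∈K , ne }) (∈-allFin m))
      glue-cong x y i i∉ (no _) = A.≈ᴹ-refl i

      glue-diagonal : ∀ x i → ¬ ((λ _ → ⊤ {ℓ}) ∖ λ i → Any (λ K → K i) Ks) i →
        ∀ d → A._≈ᴹ_ i (x i) (⟦ glueAt i d ⟧ (λ _ → x))
      glue-diagonal x i i∉ (yes _) = A.≈ᴹ-refl i
      glue-diagonal x i i∉ (no ∄m) = ⊥-elim (i∉ (_ , λ any → ∄m (Any.index any , Any.lookup-index any)))

  module _ (is : List I) (unique : Unique (≡.setoid I) is) (null : Null (λ i → i ∉ is)) where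

    private
      s : Fin (length is) → I
      s = lookup is

    extendAt : ∀ i → Dec (∃[ m ] s m ≡ i) → Hom (Π (A ∘ s)) (A i)
    extendAt i (yes (m , ≡.refl)) = projection (A ∘ s) m
    extendAt i (no _)             = zeroHom

    extendByZero : Hom (Π (A ∘ s)) (Π A)
    extendByZero = tuple (λ i → extendAt i em)

    restAt : ∀ i → Dec (∃[ m ] s m ≡ i) → Hom (Π A) (A i)
    restAt i (yes _) = zeroHom
    restAt i (no _)  = projection A i

    rest : Hom (Π A) (Π A)
    rest = tuple (λ i → restAt i em)

    extend-subproduct : ∀ x i → i ∈ is → ∀ d → A._≈ᴹ_ i (x i) (⟦ extendAt i d ⟧ (⟦ subproduct A s ⟧ x))
    extend-subproduct x i i∈ (yes (_ , ≡.refl)) = A.≈ᴹ-refl i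
    extend-subproduct x i i∈ (no ∄m) = ⊥-elim (∄m (Any.index i∈ , ≡.sym (Any.lookup-index i∈)))

    extend-+-rest : ∀ x i d →
      A._≈ᴹ_ i (x i) (A._+ᴹ_ i (⟦ extendAt i d ⟧ (⟦ subproduct A s ⟧ x)) (⟦ restAt i d ⟧ x))
    extend-+-rest x i (yes (_ , ≡.refl)) = A.≈ᴹ-sym i (A.+ᴹ-identityʳ i (x i))
    extend-+-rest x i (no _)             = A.≈ᴹ-sym i (A.+ᴹ-identityˡ i (x i))

    rest-Supported : ∀ x → Supported (λ i → i ∉ is) (⟦ rest ⟧ x)
    rest-Supported x i ¬∉ = go (stable ¬∉) em
      where
      go : i ∈ is → ∀ d → Zero i (⟦ restAt i d ⟧ x)
      go _  (yes _) = A.≈ᴹ-refl i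
      go i∈ (no ∄m) = ⊥-elim (∄m (Any.index i∈ , ≡.sym (Any.lookup-index i∈)))

    factorsThroughFiniteSubproduct : FactorsThroughFiniteSubproduct A πf
    factorsThroughFiniteSubproduct = length is , s , lookup-injective (≡.setoid I) unique ,
      πf ∘ₐ extendByZero , λ x → agree⇒≋ null (λ i ¬∉ → extend-subproduct x i (stable ¬∉) em)

    -- An element is the sum of its restrictions to the points of `is` and to the complement. Both
    -- restrictions are algebra homomorphisms, and since the complement is null, f sends the second
    -- one into Z(B).
    decomposes : Decomposes A f
    decomposes = f ∘ₐ extendByZero ∘ₐ subproduct A s , f₀ ,
      (length is , s , lookup-injective (≡.setoid I) unique , f ∘ₐ extendByZero , λ _ → B.≈ᴹ-refl) ,
      λ x → B.≈ᴹ-trans (⟦⟧-cong (λ i → extend-+-rest x i em)) (+ᴹ-homo _ _)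
      where
      h : Hom (Π A) B
      h = f ∘ₐ rest

      f₀ : Hom (Π A) (Z B)
      f₀ = mkHom (λ x → ⟦ h ⟧ x , null _ (rest-Supported x))
        (Hom.⟦⟧-cong h) (Hom.+ᴹ-homo h) (Hom.0ᴹ-homo h) (Hom.-ᴹ-homo h) (Hom.*ₗ-homo h) (Hom.·-homo h)

  -- Different atoms may concentrate at the same point; deduplication makes the indexing of the
  -- subproduct injective.
  finite-support : ∀ {Ks : List (Pred I ℓ)} → All (λ K → ∃[ i₀ ] Null (K ∖ λ i → i ≡ i₀)) Ks →
    Null ((λ _ → ⊤ {ℓ}) ∖ λ i → Any (λ K → K i) Ks) →
    ∃[ is ] Unique (≡.setoid I) is × Null (λ i → i ∉ is)
  finite-support {Ks} points null = deduplicate (λ _ _ → em) (generators points) ,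
    Unique.deduplicate-! (decSetoid (λ _ _ → em)) (generators points) ,
    Null-⊆ (λ {i} → cases i) (Null-∪ null (generators-null points))
    where
    generators : ∀ {Ks} → All (λ K → ∃[ i₀ ] Null (K ∖ λ i → i ≡ i₀)) Ks → List I
    generators = All.reduce proj₁

    generators-null : ∀ {Ks} (ps : All (λ K → ∃[ i₀ ] Null (K ∖ λ i → i ≡ i₀)) Ks) →
      Null ((λ i → Any (λ K → K i) Ks) ∖ λ i → i ∈ generators ps)
    generators-null []               = Null-empty λ { _ (() , _) }
    generators-null ((i₀ , p) ∷ ps) = Null-⊆
      (λ { (here i∈K , i∉) → inj₁ (i∈K , i∉ ∘ here) ; (there any , i∉) → inj₂ (any , i∉ ∘ there) })
      (Null-∪ p (generators-null ps))

    cases : ∀ i → i ∉ deduplicate (λ _ _ → em) (generators points) →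
      ((λ _ → ⊤ {ℓ}) ∖ λ i → Any (λ K → K i) Ks) i ⊎
      ((λ i → Any (λ K → K i) Ks) ∖ λ i → i ∈ generators points) i
    cases i i∉ with em {P = Any (λ K → K i) Ks}
    ... | yes any = inj₂ (any , i∉ ∘ ∈-deduplicate⁺ (λ _ _ → em))
    ... | no ¬any = inj₁ (_ , ¬any)

  Factorisations : ∀ {a r} → Setoid a r → Set _
  Factorisations κ = FactorsThroughUltraproducts A (Complete⁺ κ) πf ×
    (BelowMeasurablesAbove κ I → FactorsThroughFiniteSubproduct A πf × Decomposes A f)

  -- K represents κ in the universe of I, where the measurable cardinals are taken.
  module _ {a r} {κ : Setoid a r} (kernels : ∀ {s} {S : Set s} → ≡.setoid S ≼ κ → HasKernels S)
           (ℵ₀≼κ : ℵ₀ ≼ κ) {K : Set ℓ} (K≼κ : ≡.setoid K ≼ κ) (κ≼K : κ ≼ ≡.setoid K) where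
    open Measurability em ext

    complete : ∀ {J} → IsAtom J → Complete⁺ κ (ultrafilter J)
    complete atom X≼κ = ultrafilter-complete atom (kernels X≼κ)

    concentrated : BelowMeasurablesAbove κ I → ∀ {J} → IsAtom J → ∃[ i₀ ] Null (J ∖ λ i → i ≡ i₀)
    concentrated below {J} atom = singleton-large (ultrafilter J) (ultrafilter-proper atom)
      (ultrafilter-prime atom) {κ = κ} (complete atom) K≼κ κ≼K below

    factorisations : Factorisations κ
    factorisations = fromAtoms (atomic (kernels ℵ₀≼κ))
      where
      fromPoints : ∃[ is ] Unique (≡.setoid I) is × Null (λ i → i ∉ is) →
                   FactorsThroughFiniteSubproduct A πf × Decomposes A f
      fromPoints (is , unique , null) =
        factorsThroughFiniteSubproduct is unique null , decomposes is unique null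

      ultra : ∀ {J} → IsAtom J → IsUltrafilter (ultrafilter J) × Complete⁺ κ (ultrafilter J)
      ultra {J} atom =
        prime⇒ultra (ultrafilter J) (ultrafilter-proper atom) (ultrafilter-prime atom) , complete atom

      fromAtoms : Atomic (λ _ → ⊤) → Factorisations κ
      fromAtoms (Ks , atoms , null) =
        (length Ks , (λ m → ultrafilter (lookup Ks m)) ,
          (λ m → ultra (All.lookup atoms (∈-lookup m))) , factorsThroughUltraproducts Ks null) ,
        λ below → fromPoints (finite-support (All.map (concentrated below) atoms) null)

  -- Kernel elements from linear dependence

  module _ {x} {X : Set x} {b : X → B.Carrierᴹ}
           (spanning : Exchange.Spanning em ext isField B.leftModule b) where
    private module CombB = Combinations {k = k} B.leftModule

    hasKernels : ∀ {s y} {S : Set s} {Y : Set y} (u : Y → S → k.Carrier) → HasFiniteZeros u →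
      ¬ (Σ[ φ ∈ (Y → X) ] (∀ {z z′} → φ z ≡ φ z′ → z ≡ z′)) → HasKernels S
    hasKernels {S = S} u finite-zeros Y⋠X a h =
      let (z , l , off , relation) = Exchange.dependent em ext isField B.leftModule {b = b} spanning Y⋠X v
      in (λ s → u z s k.+ comb (λ z′ → u z′ s) l) ,
         B.≈ᴹ-trans (⟦⟧-cong (λ i → pull-+ (u z) _ i (h i)))
           (B.≈ᴹ-trans (+ᴹ-homo _ _) (B.≈ᴹ-trans (B.+ᴹ-congˡ (f-comb l)) relation)) ,
         finite-zeros z l off
      where
      v : _ → B.Carrierᴹ
      v z = ⟦ f ⟧ (pull h (u z) • a)

      pull-+ : ∀ (w w′ : S → k.Carrier) i m → A._≈ᴹ_ i
        (A._*ₗ_ i (maybe′ (λ s → w s k.+ w′ s) k.0# m) (a i))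
        (A._+ᴹ_ i (A._*ₗ_ i (maybe′ w k.0# m) (a i)) (A._*ₗ_ i (maybe′ w′ k.0# m) (a i)))
      pull-+ w w′ i (just s) = A.*ₗ-distribʳ i (a i) (w s) (w′ s)
      pull-+ w w′ i nothing  = A.≈ᴹ-sym i (A.≈ᴹ-trans i
        (A.+ᴹ-cong i (A.*ₗ-zeroˡ i _) (A.≈ᴹ-refl i)) (A.+ᴹ-identityˡ i _))

      pull-* : ∀ c (w : S → k.Carrier) i m → A._≈ᴹ_ i
        (A._*ₗ_ i (maybe′ (λ s → c k.* w s) k.0# m) (a i))
        (A._*ₗ_ i c (A._*ₗ_ i (maybe′ w k.0# m) (a i)))
      pull-* c w i (just s) = A.*ₗ-assoc i c (w s) (a i)
      pull-* c w i nothing  = A.≈ᴹ-trans i (A.*ₗ-zeroˡ i _) (A.≈ᴹ-sym i (*ₗ-Zero c (A.*ₗ-zeroˡ i _)))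

      pull-0 : ∀ i m → Zero i (A._*ₗ_ i (maybe′ {A = S} (λ _ → k.0#) k.0# m) (a i))
      pull-0 i (just _) = A.*ₗ-zeroˡ i _
      pull-0 i nothing  = A.*ₗ-zeroˡ i _

      f-comb : ∀ l → ⟦ f ⟧ (pull h (λ s → comb (λ z → u z s) l) • a) B.≈ᴹ CombB.comb v l
      f-comb []            = B.≈ᴹ-trans (⟦⟧-cong (λ i → pull-0 i (h i))) 0ᴹ-homo
      f-comb ((c , z) ∷ l) = B.≈ᴹ-trans
        (⟦⟧-cong (λ i → A.≈ᴹ-trans i (pull-+ (λ s → c k.* u z s) _ i (h i))
          (A.+ᴹ-cong i (pull-* c (u z) i (h i)) (A.≈ᴹ-refl i))))
        (B.≈ᴹ-trans (+ᴹ-homo _ _) (B.+ᴹ-cong (*ₗ-homo c _) (f-comb l)))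

  -- This lets the tree functions on ℕ serve every countable index set: `u` is restricted along the
  -- embedding, under which finite sets have finite preimages.
  HasKernels-mono : ∀ {s t} {S : Set s} {T : Set t} → ≡.setoid S ≼ ≡.setoid T →
                    HasKernels T → HasKernels S
  HasKernels-mono {S = S} {T} S≼T kernels a h =
    let (u , killed , zeros , cover) = kernels a (Maybe.map to ∘ h) in
    u ∘ to ,
    B.≈ᴹ-trans (⟦⟧-cong (λ i → A.*ₗ-cong i (pull-map u (h i)) (A.≈ᴹ-refl i))) killed ,
    finitelyMany-⊆ (λ s us≈0 → cover (to s) us≈0)
      (finitelyMany-Any {P = λ t s → to s ≡ t} (λ t →
        finitelyMany-unique {P = λ s → to s ≡ t} λ {s} {s′} (p : to s ≡ t) (q : to s′ ≡ t) →
          injective (≡.trans p (≡.sym q))) zeros)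
    where
    open Injection S≼T using (to; injective)

    pull-map : ∀ u m → maybe′ (u ∘ to) k.0# m k.≈ maybe′ u k.0# (Maybe.map to m)
    pull-map u (just _) = k.refl
    pull-map u nothing  = k.refl

-- Cardinalities of setoids

module Representatives (em : ∀ {a} → ExcludedMiddle a) (ext : ∀ {a b} → Extensionality a b)
                       {a ℓ} (S : Setoid a ℓ) where
  open Setoid S
  open Classical em
  open Cardinals em ext
  private module S = SetoidMembership S

  cover⇒finite : ∀ xs → (∀ x → x S.∈ xs) → Finite S
  cover⇒finite xs cover = length ys , record
    { to = position ; from = lookup ys
    ; to-cong = λ {x} {y} x≈y → lookup-injective S unique (trans (sym (at x)) (trans x≈y (at y)))
    ; from-cong = λ { ≡.refl → refl }
    ; inverse = (λ {i} {x} x≈ → lookup-injective S unique (trans (sym (at x)) x≈)) ,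
                (λ { {x} ≡.refl → sym (at x) })
    }
    where
    decSetoid′ : DecSetoid a ℓ
    decSetoid′ = record
      { isDecEquivalence = record { isEquivalence = isEquivalence ; _≟_ = λ _ _ → em } }

    ys : List Carrier
    ys = deduplicate (λ _ _ → em) xs

    unique : Unique S ys
    unique = Unique.deduplicate-! decSetoid′ xs

    found : ∀ x → x S.∈ ys
    found x = SetoidMembershipProperties.∈-deduplicate⁺ S (λ _ _ → em)
      (λ e e′ → trans e′ (sym e)) (cover x)

    position : Carrier → Fin (length ys)
    position x = Any.index (found x)

    at : ∀ x → x ≈ lookup ys (position x)
    at x = Any.lookup-index (found x)

  infinite⇒ℵ₀≼ : Infinite S → ℵ₀ ≼ S
  infinite⇒ℵ₀≼ infinite = record
    { to = term ; cong = λ { ≡.refl → refl } ; injective = λ {m} {n} → injective m n }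
    where
    another : ∀ xs → ∃[ x ] ¬ x S.∈ xs
    another xs = ¬∀⇒∃¬ (infinite ∘ cover⇒finite xs)

    initial : ℕ → List Carrier
    initial zero    = []
    initial (suc n) = proj₁ (another (initial n)) ∷ initial n

    term : ℕ → Carrier
    term n = proj₁ (another (initial n))

    term∈ : ∀ {m n} → m ℕ.< n → term m S.∈ initial n
    term∈ {m} {suc n} m<1+n with ℕ.m≤n⇒m<n∨m≡n (ℕ.s≤s⁻¹ m<1+n)
    ... | inj₁ m<n    = there (term∈ m<n)
    ... | inj₂ ≡.refl = here refl

    injective : ∀ m n → term m ≈ term n → m ≡ n
    injective m n e with ℕ.<-cmp m n
    ... | tri≈ _ m≡n _ = m≡n
    ... | tri< m<n _ _ = ⊥-elim (proj₂ (another (initial n))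
            (SetoidMembershipProperties.∈-resp-≈ S e (term∈ m<n)))
    ... | tri> _ _ n<m = ⊥-elim (proj₂ (another (initial m))
            (SetoidMembershipProperties.∈-resp-≈ S (sym e) (term∈ n<m)))

  class : Carrier → Subset Carrier
  class x y = ⌊ y ≈ x ⌋

  class-cong : ∀ {x y} → x ≈ y → class x ≡ class y
  class-cong x≈y = ext λ z → T-ext
    (λ z∈ → to⌊⌋ (trans (from⌊⌋ z∈) x≈y)) (λ z∈ → to⌊⌋ (trans (from⌊⌋ z∈) (sym x≈y)))

  private
    select : (C : Subset Carrier) → ∃[ z ] T (C z) → Dec (∃[ z ] T (C z)) → Carrier
    select C _       (yes (z , _)) = z
    select C (z , _) (no _)        = z

    select-irrelevant : ∀ (C : Subset Carrier) p q d → select C p d ≡ select C q d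
    select-irrelevant C p q (yes _) = ≡.refl
    select-irrelevant C p q (no ¬∃) = ⊥-elim (¬∃ p)

    select-∈ : ∀ (C : Subset Carrier) p d → T (C (select C p d))
    select-∈ C _       (yes (_ , z∈)) = z∈
    select-∈ C (_ , z∈) (no _)        = z∈

    self : ∀ x → ∃[ z ] T (class x z)
    self x = x , to⌊⌋ refl

  -- The choice is made from the Bool-valued class, which by extensionality does not
  -- depend on the element that it was built from.
  representative : Carrier → Carrier
  representative x = select (class x) (self x) em

  representative-≈ : ∀ x → representative x ≈ x
  representative-≈ x = from⌊⌋ (select-∈ (class x) (self x) em)

  representative-cong : ∀ {x y} → x ≈ y → representative x ≡ representative y
  representative-cong {x} {y} x≈y = go (class-cong x≈y) (self x) (self y)
    where
    go : ∀ {C D : Subset Carrier} → C ≡ D → ∀ p q → select C p em ≡ select D q em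
    go {C} ≡.refl p q = select-irrelevant C p q em

  -- A transversal of the equality, for use where a cardinal must be a type with propositional
  -- equality: as the index set of the reciprocals and as the copy of card(k) compared with
  -- measurable cardinals.
  Representative : Set a
  Representative = Elements (λ x → ⌊ representative x ≡ x ⌋)

  Representative-≡ : ∀ {x y : Representative} → proj₁ x ≈ proj₁ y → x ≡ y
  Representative-≡ {_ , p} {_ , q} x≈y = Elements-≡
    (≡.trans (≡.sym (from⌊⌋ p)) (≡.trans (representative-cong x≈y) (from⌊⌋ q)))

  Representative≼ : ≡.setoid Representative ≼ S
  Representative≼ = record
    { to = proj₁ ; cong = λ { ≡.refl → refl } ; injective = Representative-≡ }

  ≼Representative : S ≼ ≡.setoid Representative
  ≼Representative = record
    { to        = λ x → representative x , to⌊⌋ (representative-cong (representative-≈ x))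
    ; cong      = λ x≈y → Elements-≡ (representative-cong x≈y)
    ; injective = λ {x} {y} e → trans (sym (representative-≈ x))
        (trans (reflexive (cong proj₁ e)) (representative-≈ y))
    }

theorem8 : (∀ {a} → ExcludedMiddle a) → (∀ {a b} → Extensionality a b) →
    ∀ {ℓ : Level} (k : CommutativeRing ℓ ℓ) → IsField k → Infinite (CommutativeRing.setoid k) →
    (I : Set ℓ) (A : I → Algebra k ℓ ℓ) (B : Algebra k ℓ ℓ) (f : Hom (Π A) B) → IsSurjective f →
    (Dimension≺ B (CommutativeRing.setoid k) →
    FactorsThroughUltraproducts A (Complete⁺ (CommutativeRing.setoid k)) (π B ∘ₐ f) ×
    (BelowMeasurablesAbove (CommutativeRing.setoid k) I →
    FactorsThroughFiniteSubproduct A (π B ∘ₐ f) × Decomposes A f)) ×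
    (Dimension≺ B 2^ℵ₀ →
    FactorsThroughUltraproducts A (Complete⁺ ℵ₀) (π B ∘ₐ f) ×
    (BelowMeasurablesAbove ℵ₀ I →
    FactorsThroughFiniteSubproduct A (π B ∘ₐ f) × Decomposes A f))
theorem8 em ext {ℓ} k isField infinite I A B f f-surjective = below-card-k , below-continuum
  where
  module k = CommutativeRing k
  module P = Products em ext isField A B f f-surjective
  open FiniteZeros em ext isField using (module Cauchy)
  open Representatives em ext k.setoid

  ℵ₀≼k : ℵ₀ ≼ k.setoid
  ℵ₀≼k = infinite⇒ℵ₀≼ infinite

  below-card-k : Dimension≺ B k.setoid → P.Factorisations k.setoid
  below-card-k (X , (b , basis) , _ , k⋠X) =
    P.factorisations kernels ℵ₀≼k Representative≼ ≼Representative
    where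
    kernels : ∀ {s} {S : Set s} → ≡.setoid S ≼ k.setoid → P.HasKernels S
    kernels S≼k = P.hasKernels {b = b} (IsBasis.spanning basis) C.reciprocal C.hasFiniteZeros
      λ (φ , φ-injective) → k⋠X (Composition.injection ≼Representative (mk↣ φ-injective))
      where
      module C = Cauchy {Y = Representative} proj₁ Representative-≡
                   (Injection.to S≼k) (Injection.injective S≼k)

  below-continuum : Dimension≺ B 2^ℵ₀ → P.Factorisations ℵ₀
  below-continuum (X , (b , basis) , _ , 2^ℵ₀⋠X) =
    P.factorisations kernels (Composition.injection (mk↣ id) (mk↣ id))
      {K = Lift ℓ ℕ} (mk↣ {to = lower} λ { ≡.refl → ≡.refl }) (mk↣ {to = lift} λ { ≡.refl → ≡.refl })
    where
    module t = Injection ℵ₀≼k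
    -- The generic choices draw on a sequence of distinct scalars, so `k` may be countable.
    open Tree em ext isField t.to t.injective

    kernels : ∀ {s} {S : Set s} → ≡.setoid S ≼ ℵ₀ → P.HasKernels S
    kernels S≼ℵ₀ = P.HasKernels-mono S≼ℵ₀
      (P.hasKernels {b = b} (IsBasis.spanning basis) branch branch-hasFiniteZeros
        -- `2^ℵ₀` carries pointwise equality, which extensionality identifies with equality of
        -- branches.
        λ (φ , φ-injective) → 2^ℵ₀⋠X record
          { to        = φ
          ; cong      = λ s≗s′ → cong φ (ext s≗s′)
          ; injective = λ e n → cong (λ s → s n) (φ-injective e)
          })
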